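{- Let $n\geq 2$ and $q=p^h$ with $p$ prime and $h\geq 1$. The minimum weight of the code $C\cap C^\perp$, where $C=C(PG(n,q))$, is equal to $2q^{n-1}$. This weight is attained by $H_1-H_2$, the difference of the incidence vectors of two distinct hyperplanes $H_1,H_2$ of $PG(n,q)$.
   Context: $PG(n,q)$ is the Desarguesian $n$-dimensional projective space over $\mathbb{F}_q$. The code $C=C(PG(n,q))$ is the $\mathbb{F}_p$-linear span, inside $\mathbb{F}_p^{\theta_n}$ with $\theta_n=(q^{n+1}-1)/(q-1)$, of the rows of the incidence matrix whose rows are indexed by the hyperplanes and whose columns are indexed by the points of $PG(n,q)$. A row has entry $1$ if the point lies in the hyperplane and $0$ otherwise. $C^\perp$ is its dual with respect to the standard scalar product over $\mathbb{F}_p$. The weight of a vector is the size of its support, the set of nonzero coordinates, which is identified with a set of points. -}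

module Defs where

open import Algebra.Bundles using (CommutativeRing)
open import Algebra.Definitions.RawMonoid using () renaming (sum to monoidSum)
open import Data.Bool.Base using (if_then_else_)
open import Data.Fin.Base using (Fin)
open import Data.Fin.Properties as Fin using (any?; all?)
open import Data.Fin.Subset using (Subset; ∣_∣)
open import Data.List.Base as List
  using (List; []; _∷_; allFin; cartesianProductWith; deduplicate; filter; length)
open import Data.Nat.Base using (ℕ; zero; suc; _≤_)
open import Data.Product.Base using (∃; ∃-syntax; _×_; _,_)
import Data.Vec.Base as Vec
open import Data.Vec.Functional as Vector using (Vector)
open import Function.Bundles using (Inverse)
open import Function.Properties.Inverse using (Inverse⇒Injection)
open import Level as Level using (Level; _⊔_)
open import Relation.Binary.Core using (Rel)
open import Relation.Binary.Definitions using (Decidable)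
open import Relation.Binary.PropositionalEquality as ≡ using (_≡_)
open import Relation.Nullary using (¬_; does)
open import Relation.Nullary.Decidable using (¬?; _×-dec_; map′)
open import Relation.Unary using (Pred; _∩_; _∈_)

-- A field with exactly q elements.
record FiniteField (c ℓ : Level) (q : ℕ) : Set (Level.suc (c ⊔ ℓ)) where
  field
    commutativeRing : CommutativeRing c ℓ

  open CommutativeRing commutativeRing public

  field
    0≉1      : ¬ (0# ≈ 1#)
    inverses : ∀ x → ¬ (x ≈ 0#) → ∃[ y ] x * y ≈ 1#
    finite   : Inverse (CommutativeRing.setoid commutativeRing) (≡.setoid (Fin q))

  infix 4 _≟_

  _≟_ : Decidable _≈_
  _≟_ = Fin.inj⇒≟ (Inverse⇒Injection finite)

  elements : List Carrier
  elements = List.map (Inverse.from finite) (allFin q)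

  sum : ∀ {m} → Vector Carrier m → Carrier
  sum = monoidSum +-rawMonoid

  infix 7 _·_
  infix 4 _≋_

  _·_ : ∀ {m} → Vector Carrier m → Vector Carrier m → Carrier
  u · v = sum (λ i → u i * v i)

  _≋_ : ∀ {m} → Rel (Vector Carrier m) ℓ
  u ≋ v = ∀ i → u i ≈ v i

  0ᵛ : ∀ {m} → Vector Carrier m
  0ᵛ _ = 0#

  _≋?_ : ∀ {m} → Decidable (_≋_ {m})
  u ≋? v = all? (λ i → u i ≟ v i)

module ProjectiveSpace {c ℓ q} (F : FiniteField c ℓ q) (n : ℕ) where
  open FiniteField F

  -- Homogeneous coordinates of a point, or dual coordinates of a hyperplane.
  Coordinates : Set c
  Coordinates = Vector Carrier (suc n)

  infix 4 _∼_ _∼?_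

  _∼_ : Rel Coordinates (c ⊔ ℓ)
  x ∼ y = ∃[ s ] ¬ (s ≈ 0#) × (∀ i → x i ≈ s * y i)

  _∼?_ : Decidable _∼_
  x ∼? y = map′
    (λ { (k , k≉0 , x≈ky) → from k , k≉0 , x≈ky })
    (λ { (s , s≉0 , x≈sy) →
           let k≈s = inverseʳ {x = s} ≡.refl in
           to s
         , (λ k≈0 → s≉0 (trans (sym k≈s) k≈0))
         , (λ i → trans (x≈sy i) (*-congʳ (sym k≈s))) })
    (any? (λ k → ¬? (from k ≟ 0#) ×-dec all? (λ i → x i ≟ from k * y i)))
    where
    open Inverse finite using (to; from; inverseʳ)

  vectors : ∀ m → List (Vector Carrier m)
  vectors zero    = Vector.[] ∷ []
  vectors (suc m) = cartesianProductWith Vector._∷_ elements (vectors m)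

  -- One representative of each proportionality class of nonzero vectors,
  -- i.e. one spanning vector for each one-dimensional subspace of Fⁿ⁺¹.
  representatives : List Coordinates
  representatives = deduplicate _∼?_ (filter (λ x → ¬? (x ≋? 0ᵛ)) (vectors (suc n)))

  θ : ℕ
  θ = length representatives

  Point : Set
  Point = Fin θ

  -- A hyperplane is the kernel of a nonzero linear form, and the form is
  -- determined by the hyperplane up to a nonzero scalar; hence the coefficient
  -- vectors of the forms run over the same representatives as the points do.
  Hyperplane : Set
  Hyperplane = Fin θ

  homogeneous : Point → Coordinates
  homogeneous = List.lookup representatives

  equation : Hyperplane → Coordinates
  equation = List.lookup representatives

  Incident : Point → Hyperplane → Set ℓ
  Incident P H = equation H · homogeneous P ≈ 0#

  incident? : Decidable Incident
  incident? P H = equation H · homogeneous P ≟ 0#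

module Codes {c ℓ p} (K : FiniteField c ℓ p) where
  open FiniteField K

  Word : ℕ → Set c
  Word m = Vector Carrier m

  -- The linear span of the rows of a matrix.
  rowSpan : ∀ {k m} → (Fin k → Word m) → Pred (Word m) (c ⊔ ℓ)
  rowSpan {k} A v = ∃ λ (a : Vector Carrier k) → v ≋ (λ j → sum (λ i → a i * A i j))

  infix 10 _⊥

  _⊥ : ∀ {m l} → Pred (Word m) l → Pred (Word m) (c ⊔ ℓ ⊔ l)
  (C ⊥) v = ∀ u → u ∈ C → v · u ≈ 0#

  support : ∀ {m} → Word m → Subset m
  support v = Vec.tabulate (λ i → does (¬? (v i ≟ 0#)))

  weight : ∀ {m} → Word m → ℕ
  weight v = ∣ support v ∣

  IsMinimumWeight : ∀ {m l} → Pred (Word m) l → ℕ → Set (c ⊔ ℓ ⊔ l)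
  IsMinimumWeight C w =
      (∃[ v ] v ∈ C × ¬ (v ≋ 0ᵛ) × weight v ≡ w)
    × (∀ v → v ∈ C → ¬ (v ≋ 0ᵛ) → w ≤ weight v)

  infixl 6 _⊖_

  _⊖_ : ∀ {m} → Word m → Word m → Word m
  (u ⊖ v) i = u i - v i

-- The code of points and hyperplanes of PG(n, F) over K.
module PointHyperplaneCode
  {c ℓ q c′ ℓ′ p} (n : ℕ) (F : FiniteField c ℓ q) (K : FiniteField c′ ℓ′ p) where
  open ProjectiveSpace F n public
  open Codes K public
  open FiniteField K using (0#; 1#)

  incidenceVector : Hyperplane → Word θ
  incidenceVector H P = if does (incident? P H) then 1# else 0#

  C : Pred (Word θ) (c′ ⊔ ℓ′)
  C = rowSpan incidenceVector

  hull : Pred (Word θ) (c′ ⊔ ℓ′)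
  hull = C ∩ C ⊥

{-# OPTIONS --safe #-}

-- The differences H₁ - H₂ span the hull, because any two hyperplanes, equal or not, have scalar
-- product 1 in K. By Fermat a hull word is therefore, up to sign, a function on the points given by
-- a sum f of (q - 1)-st powers of linear forms, and its weight is the number of x with f x ≠ 0,
-- divided by q - 1.
--
-- Let S be a maximal subspace on which f vanishes, and let v ∉ S. As f vanishes on S, the function
-- x ↦ f (v + x) on S is a polynomial of degree d ≤ q - 2, and it is not zero, by maximality. Choose
-- y ∈ S at which its leading form does not vanish. On every line in the direction y the polynomial
-- then has degree exactly d, hence at least q - d ≥ 2 non-roots. Averaging over these lines and over v,
-- at least 2 / q of the vectors outside S are in the support of f; as S is proper, this is at least
-- 2 (q - 1) qⁿ⁻¹ vectors.

module Submission where

open import Defs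
open import Algebra.Bundles using (CommutativeMonoid)
import Algebra.Properties.CommutativeMonoid.Sum as MonoidSum
import Algebra.Properties.CommutativeSemigroup as CommutativeSemigroupProperties
import Algebra.Properties.Semiring.Sum as SemiringSum
open import Data.Bool.Base using (true; false; if_then_else_)
open import Data.Empty using (⊥-elim)
open import Data.Fin.Base as Fin using (Fin; zero; suc; punchIn; punchOut; toℕ; combine; funToFin; finToFun)
open import Data.Fin.Permutation using (Permutation; permutation)
import Data.Fin.Properties as Fin
open import Data.Fin.Subset using (∣_∣)
open import Data.List.Base as List using (List; []; _∷_)
open import Data.List.Membership.Propositional.Properties using (∈-lookup)
open import Data.List.Relation.Unary.All as All using (All; []; _∷_)
import Data.List.Relation.Unary.All.Properties as All
open import Data.List.Relation.Unary.AllPairs using (AllPairs; []; _∷_)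
open import Data.List.Relation.Unary.Any as Any using (Any; here)
import Data.List.Relation.Unary.Any.Properties as Any
import Data.List.Relation.Unary.Unique.DecSetoid.Properties as Unique
open import Data.Nat.Base as ℕ using (ℕ; zero; suc; _∸_; z≤n; s≤s)
open import Data.Nat.Coprimality as Coprime using (Coprime)
open import Data.Nat.Divisibility as ∣ using (_∣_; divides)
open import Data.Nat.GCD using (module Bézout)
open import Data.Nat.Primality using (Prime; prime⇒irreducible)
import Data.Nat.Properties as ℕ
import Data.Nat.Solver
open import Data.Product using (∃-syntax; _×_; _,_; proj₁; proj₂)
open import Data.Sum.Base using (_⊎_; inj₁; inj₂)
open import Data.Unit.Base using (tt)
import Data.Vec.Base as Vec
open import Data.Vec.Functional using (Vector)
open import Function.Base using (_∘_; id)
open import Function.Bundles using (Inverse)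
import Function.Construct.Identity as Identity
open import Function.Definitions using (Injective)
open import Level using (Level; _⊔_; Lift; lift; lower)
open import Relation.Binary.Bundles using (Setoid; DecSetoid)
open import Relation.Binary.Core using (Rel; _Preserves_⟶_)
open import Relation.Binary.Definitions using (_Respects_; Symmetric)
open import Relation.Binary.PropositionalEquality as ≡ using (_≡_; _≢_)
open import Relation.Nullary using (Dec; yes; no; ¬_; does; contradiction)
open import Relation.Nullary.Decidable using (¬?; _×-dec_; map′; decidable-stable)
open import Relation.Unary using (Pred; Decidable; _∈_; _∉_; _⊆_)

-- Counting in finite setoids

-- The factor 2 is the drop from degree q - 1 to q - 2. Each summand (h·v + h·x)^(q - 1) has the top
-- form (h·x)^(q - 1), so the top form of x ↦ f (v + x) is f itself, whatever v is, and this is zero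
-- on S. With degree q - 1 a line would be sure of one non-root only, which gives half the bound.
-- Maximality acts through homogeneity: f (s x) = f x for nonzero s, so on the span of S and v the
-- function is determined by its values on S and on v + S. Were it zero on v + S, then S could be
-- enlarged. The constant term of f disappears because the coefficients of a hull word add up to
-- zero, as its product with any single row shows. The coefficients lie in K and the linear forms
-- are over F, and neither field is given inside the other. Natural numbers representing the
-- coefficients are read in both, and only vanishing, that is divisibility by p, is compared.
-- Dimension is replaced by counting: for v outside S the q translates of S along v are disjoint, so
-- S has at most q^n elements.

module ΣN = SemiringSum ℕ.+-*-semiring
open ΣN using () renaming (sum to sumℕ)

[_] : ∀ {a} {A : Set a} → Dec A → ℕ
[ A? ] = if does A? then 1 else 0

[]-yes : ∀ {a} {A : Set a} (A? : Dec A) → A → [ A? ] ≡ 1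
[]-yes (yes _) _ = ≡.refl
[]-yes (no ¬a) a = contradiction a ¬a

[]-no : ∀ {a} {A : Set a} (A? : Dec A) → ¬ A → [ A? ] ≡ 0
[]-no (yes a) ¬a = contradiction a ¬a
[]-no (no _)  _  = ≡.refl

[]-mono : ∀ {a b} {A : Set a} {B : Set b} (A? : Dec A) (B? : Dec B) → (A → B) → [ A? ] ℕ.≤ [ B? ]
[]-mono (no _)  B? _ = z≤n
[]-mono (yes a) B? f = ℕ.≤-reflexive (≡.sym ([]-yes B? (f a)))

[]-cong : ∀ {a b} {A : Set a} {B : Set b} (A? : Dec A) (B? : Dec B) → (A → B) → (B → A) → [ A? ] ≡ [ B? ]
[]-cong A? B? f g = ℕ.≤-antisym ([]-mono A? B? f) ([]-mono B? A? g)

[]-× : ∀ {a b} {A : Set a} {B : Set b} (A? : Dec A) (B? : Dec B) → [ A? ×-dec B? ] ≡ [ A? ] ℕ.* [ B? ]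
[]-× (no _)  _       = ≡.refl
[]-× (yes _) (no _)  = ≡.refl
[]-× (yes _) (yes _) = ≡.refl

[]-¬ : ∀ {a} {A : Set a} (A? : Dec A) → [ A? ] ℕ.+ [ ¬? A? ] ≡ 1
[]-¬ (yes _) = ≡.refl
[]-¬ (no _)  = ≡.refl

module _ {c ℓ} (M : CommutativeMonoid c ℓ) where
  open CommutativeMonoid M
  open MonoidSum M
  open import Relation.Binary.Reasoning.Setoid setoid

  sum-single : ∀ {n} (t : Vector Carrier n) i → (∀ j → j ≢ i → t j ≈ ε) → sum t ≈ t i
  sum-single {suc n} t i t≈ε = begin
    sum t                              ≈⟨ sum-remove t ⟩
    t i ∙ sum (λ j → t (punchIn i j))  ≈⟨ ∙-congˡ (sum-cong-≋ (λ j → t≈ε _ (Fin.punchInᵢ≢i i j))) ⟩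
    t i ∙ sum {n} (λ _ → ε)            ≈⟨ ∙-congˡ (sum-replicate-zero n) ⟩
    t i ∙ ε                            ≈⟨ identityʳ _ ⟩
    t i                                ∎

sum-mono : ∀ {n} {s t : Vector ℕ n} → (∀ i → s i ℕ.≤ t i) → sumℕ s ℕ.≤ sumℕ t
sum-mono {zero}  s≤t = z≤n
sum-mono {suc n} s≤t = ℕ.+-mono-≤ (s≤t zero) (sum-mono (s≤t ∘ suc))

-- One module counts field elements, vectors and points alike. `Sums` takes any commutative monoid
-- because, besides counts in ℕ, it has to yield sums in the field (for the characteristic) and
-- products (for Fermat).
module Enumeration {a ℓ N} {S : Setoid a ℓ} (enum : Inverse S (≡.setoid (Fin N))) where
  open Setoid S
  open Inverse enum renaming (to to index; from to element; to-cong to index-cong)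

  element-index : ∀ x → element (index x) ≈ x
  element-index x = inverseʳ ≡.refl

  index-element : ∀ i → index (element i) ≡ i
  index-element i = inverseˡ refl

  any? : ∀ {p} {P : Pred Carrier p} → P Respects _≈_ → Decidable P → Dec (∃[ x ] P x)
  any? resp P? = map′ (λ { (i , Pi) → element i , Pi })
    (λ { (x , Px) → index x , resp (sym (element-index x)) Px })
    (Fin.any? (λ i → P? (element i)))

  module Sums {c ℓ′} (M : CommutativeMonoid c ℓ′) where
    private
      module M = CommutativeMonoid M
      open MonoidSum M

    ∑ : (Carrier → M.Carrier) → M.Carrier
    ∑ φ = sum (λ i → φ (element i))

    ∑-reindex : (σ τ : Carrier → Carrier) → σ Preserves _≈_ ⟶ _≈_ → τ Preserves _≈_ ⟶ _≈_ →
                (∀ x → σ (τ x) ≈ x) → (∀ x → τ (σ x) ≈ x) →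
                (φ : Carrier → M.Carrier) → φ Preserves _≈_ ⟶ M._≈_ →
                ∑ φ M.≈ ∑ (λ x → φ (σ x))
    ∑-reindex σ τ σ-cong τ-cong στ τσ φ φ-cong = M.trans
      (sum-permute (λ i → φ (element i)) π)
      (sum-cong-≋ {N} (λ i → φ-cong (element-index (σ (element i)))))
      where
      π : Permutation N N
      π = permutation (λ i → index (σ (element i))) (λ i → index (τ (element i)))
        (λ _ → ≡.trans (index-cong (trans (σ-cong (element-index _)) (στ _))) (index-element _))
        (λ _ → ≡.trans (index-cong (trans (τ-cong (element-index _)) (τσ _))) (index-element _))

    ∑-single : (φ : Carrier → M.Carrier) → φ Preserves _≈_ ⟶ M._≈_ →
               ∀ a → (∀ x → ¬ (x ≈ a) → φ x M.≈ M.ε) → ∑ φ M.≈ φ a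
    ∑-single φ φ-cong a φ≈ε = M.trans
      (sum-single M _ (index a) (λ j j≢ → φ≈ε _ (λ j≈ → j≢ (≡.trans (≡.sym (index-element j)) (index-cong j≈)))))
      (φ-cong (element-index a))

  open Sums ℕ.+-0-commutativeMonoid public

  ∑-cong : {φ ψ : Carrier → ℕ} → (∀ x → φ x ≡ ψ x) → ∑ φ ≡ ∑ ψ
  ∑-cong φ≡ψ = ΣN.sum-cong-≗ (λ i → φ≡ψ (element i))

  ∑-mono : {φ ψ : Carrier → ℕ} → (∀ x → φ x ℕ.≤ ψ x) → ∑ φ ℕ.≤ ∑ ψ
  ∑-mono φ≤ψ = sum-mono (λ i → φ≤ψ (element i))

  ∑-+ : (φ ψ : Carrier → ℕ) → ∑ (λ x → φ x ℕ.+ ψ x) ≡ ∑ φ ℕ.+ ∑ ψ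
  ∑-+ φ ψ = ΣN.∑-distrib-+ (φ ∘ element) (ψ ∘ element)

  ∑-*ˡ : ∀ k (φ : Carrier → ℕ) → ∑ (λ x → k ℕ.* φ x) ≡ k ℕ.* ∑ φ
  ∑-*ˡ k φ = ≡.sym (ΣN.*-distribˡ-sum k (φ ∘ element))

  ∑-*ʳ : ∀ k (φ : Carrier → ℕ) → ∑ (λ x → φ x ℕ.* k) ≡ ∑ φ ℕ.* k
  ∑-*ʳ k φ = ≡.sym (ΣN.*-distribʳ-sum k (φ ∘ element))

  ∑-const : ∀ k → ∑ (λ _ → k) ≡ N ℕ.* k
  ∑-const k = const N
    where
    const : ∀ n → sumℕ {n} (λ _ → k) ≡ n ℕ.* k
    const zero    = ≡.refl
    const (suc n) = ≡.cong (k ℕ.+_) (const n)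

  # : ∀ {p} {P : Pred Carrier p} → Decidable P → ℕ
  # P? = ∑ (λ x → [ P? x ])

  module _ {p} {P : Pred Carrier p} (P? : Decidable P) where

    #≡0 : (∀ x → ¬ P x) → # P? ≡ 0
    #≡0 ¬P = ≡.trans (∑-cong (λ x → []-no (P? x) (¬P x))) (≡.trans (∑-const 0) (ℕ.*-zeroʳ N))

    #≡1 : P Respects _≈_ → (∀ {x y} → P x → P y → x ≈ y) → ∀ a → P a → # P? ≡ 1
    #≡1 resp unique a Pa = ≡.trans
      (∑-single (λ x → [ P? x ]) (λ x≈y → []-cong (P? _) (P? _) (resp x≈y) (resp (sym x≈y))) a
        (λ x x≉a → []-no (P? x) (λ Px → x≉a (unique Px Pa))))
      ([]-yes (P? a) Pa)

    #≤1 : P Respects _≈_ → (∀ {x y} → P x → P y → x ≈ y) → # P? ℕ.≤ 1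
    #≤1 resp unique with any? resp P?
    ... | yes (a , Pa) = ℕ.≤-reflexive (#≡1 resp unique a Pa)
    ... | no ¬P        = ℕ.≤-trans (ℕ.≤-reflexive (#≡0 (λ x Px → ¬P (x , Px)))) z≤n

    #-complement : # P? ℕ.+ # (λ x → ¬? (P? x)) ≡ N
    #-complement = ≡.trans (≡.sym (∑-+ (λ x → [ P? x ]) (λ x → [ ¬? (P? x) ])))
      (≡.trans (∑-cong (λ x → []-¬ (P? x))) (≡.trans (∑-const 1) (ℕ.*-identityʳ N)))

∑-swap : ∀ {a ℓ M b ℓ′ N} {S : Setoid a ℓ} {T : Setoid b ℓ′}
         (s : Inverse S (≡.setoid (Fin M))) (t : Inverse T (≡.setoid (Fin N))) →
         (φ : Setoid.Carrier S → Setoid.Carrier T → ℕ) →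
         Enumeration.∑ s (λ x → Enumeration.∑ t (φ x)) ≡ Enumeration.∑ t (λ y → Enumeration.∑ s (λ x → φ x y))
∑-swap s t φ = ΣN.∑-comm (λ i j → φ (Inverse.from s i) (Inverse.from t j))

-- Finite fields

-- Pigeonhole: if `y` were missed, punching it out of the codomain would inject `Fin (suc n)` into
-- `Fin n`.
injective⇒surjective : ∀ {n} {f : Fin n → Fin n} → Injective _≡_ _≡_ f → ∀ y → ∃[ x ] f x ≡ y
injective⇒surjective {suc n} {f} f-inj y with Fin.any? (λ x → f x Fin.≟ y)
... | yes x     = x
... | no  ¬fx≡y = ⊥-elim (Fin.<⇒notInjective {f = λ x → punchOut (y≢f x)} ℕ.≤-refl
  (λ {i} {j} eq → f-inj {i} {j} (Fin.punchOut-injective (y≢f i) (y≢f j) eq)))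
  where
  y≢f : ∀ x → y ≢ f x
  y≢f x y≡fx = ¬fx≡y (x , ≡.sym y≡fx)

module FieldProperties {c ℓ q} (F : FiniteField c ℓ q) where
  open FiniteField F hiding (zero)
  open import Algebra.Properties.Ring ring public
  open import Algebra.Properties.Semiring.Exp semiring public
  open import Algebra.Properties.Semiring.Mult semiring public renaming (_×_ to _×′_)
  open import Algebra.Properties.Semiring.Sum semiring public
    hiding (sum)
  open import Relation.Binary.Reasoning.Setoid setoid

  module 𝔽 where
    open Enumeration finite public
    open Inverse finite public using () renaming (to to index; from to element)

  no-zero-divisors : ∀ {x y} → x * y ≈ 0# → x ≈ 0# ⊎ y ≈ 0#
  no-zero-divisors {x} {y} xy≈0 with x ≟ 0#
  ... | yes x≈0 = inj₁ x≈0
  ... | no  x≉0 = let z , xz≈1 = inverses x x≉0 in inj₂ (begin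
    y            ≈⟨ *-identityˡ y ⟨
    1# * y       ≈⟨ *-congʳ (trans (*-comm z x) xz≈1) ⟨
    z * x * y    ≈⟨ *-assoc z x y ⟩
    z * (x * y)  ≈⟨ *-congˡ xy≈0 ⟩
    z * 0#       ≈⟨ zeroʳ z ⟩
    0#           ∎)

  *-nonzero : ∀ {x y} → ¬ x ≈ 0# → ¬ y ≈ 0# → ¬ x * y ≈ 0#
  *-nonzero x≉0 y≉0 xy≈0 with no-zero-divisors xy≈0
  ... | inj₁ x≈0 = x≉0 x≈0
  ... | inj₂ y≈0 = y≉0 y≈0

  *-cancelˡ-nonzero : ∀ {x y z} → ¬ x ≈ 0# → x * y ≈ x * z → y ≈ z
  *-cancelˡ-nonzero {x} {y} {z} x≉0 xy≈xz with no-zero-divisors {x} {y - z} (begin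
    x * (y - z)    ≈⟨ x[y-z]≈xy-xz x y z ⟩
    x * y - x * z  ≈⟨ x≈y⇒x∙y⁻¹≈ε xy≈xz ⟩
    0#             ∎)
  ... | inj₁ x≈0   = contradiction x≈0 x≉0
  ... | inj₂ y-z≈0 = x∙y⁻¹≈ε⇒x≈y y z y-z≈0

  inverse : ∀ x → ¬ x ≈ 0# → ∃[ y ] (y * x ≈ 1# × ¬ y ≈ 0#)
  inverse x x≉0 = let y , xy≈1 = inverses x x≉0 in
    y , trans (*-comm y x) xy≈1 , λ y≈0 → 0≉1 (trans (sym (trans (*-congˡ y≈0) (zeroʳ x))) xy≈1)

  ^-distrib-* : ∀ x y k → (x * y) ^ k ≈ x ^ k * y ^ k
  ^-distrib-* x y zero    = sym (*-identityˡ 1#)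
  ^-distrib-* x y (suc k) = trans (*-congˡ (^-distrib-* x y k)) (interchange x y (x ^ k) (y ^ k))
    where open import Algebra.Properties.CommutativeSemigroup *-commutativeSemigroup

  -- Translation by `1#` permutes the field, so the sum of all elements equals itself plus q times
  -- `1#`.
  ×1≈0 : q ×′ 1# ≈ 0#
  ×1≈0 = +-cancelˡ (∑ (λ x → x)) _ _ (begin
    ∑ (λ x → x) + q ×′ 1#          ≈⟨ +-congˡ (sum-replicate q) ⟨
    ∑ (λ x → x) + ∑ (λ _ → 1#)    ≈⟨ ∑-distrib-+ {q} _ _ ⟨
    ∑ (λ x → x + 1#)              ≈⟨ ∑-reindex (_+ 1#) (_- 1#) +-congʳ +-congʳ
                                       (λ x → [x-y]+y≈x x 1#) (λ x → [x+y]-y≈x x 1#) (λ x → x) (λ x≈y → x≈y) ⟨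
    ∑ (λ x → x)                   ≈⟨ +-identityʳ _ ⟨
    ∑ (λ x → x) + 0#              ∎)
    where
    open 𝔽.Sums +-commutativeMonoid
    [x-y]+y≈x : ∀ x y → x - y + y ≈ x
    [x-y]+y≈x x y = trans (+-assoc x (- y) y) (trans (+-congˡ (-‿inverseˡ y)) (+-identityʳ x))
    [x+y]-y≈x : ∀ x y → x + y - y ≈ x
    [x+y]-y≈x x y = trans (+-assoc x y (- y)) (trans (+-congˡ (-‿inverseʳ y)) (+-identityʳ x))

  nonzero? : ∀ x → Dec (¬ x ≈ 0#)
  nonzero? x = ¬? (x ≟ 0#)

  -- In the counts below, `𝔽.# nonzero?` stands for q - 1, free of truncated subtraction.
  1+#nonzero : suc (𝔽.# nonzero?) ≡ q
  1+#nonzero = ≡.trans (≡.cong (ℕ._+ 𝔽.# nonzero?) (≡.sym #zero)) (𝔽.#-complement (_≟ 0#))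
    where
    #zero : 𝔽.# (_≟ 0#) ≡ 1
    #zero = 𝔽.#≡1 (_≟ 0#) (λ x≈y x≈0 → trans (sym x≈y) x≈0) (λ x≈0 y≈0 → trans x≈0 (sym y≈0)) 0# refl

  #nonzero>0 : 0 ℕ.< 𝔽.# nonzero?
  #nonzero>0 = ℕ.≤-trans
    (ℕ.≤-reflexive (≡.sym (𝔽.#≡1 (_≟ 1#) (λ x≈y x≈1 → trans (sym x≈y) x≈1) (λ x≈1 y≈1 → trans x≈1 (sym y≈1)) 1# refl)))
    (𝔽.∑-mono (λ x → []-mono (x ≟ 1#) (nonzero? x) (λ x≈1 x≈0 → 0≉1 (trans (sym x≈0) x≈1))))

  instance
    q≢0 : ℕ.NonZero q
    q≢0 = ≡.subst ℕ.NonZero 1+#nonzero _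

    #nonzero≢0 : ℕ.NonZero (𝔽.# nonzero?)
    #nonzero≢0 = ℕ.>-nonZero #nonzero>0

  -- The exponent has to be positive, since `x ^ 0` is `1#` even at zero; a field has a nonzero
  -- element, namely `1#`.
  ^[q-1]≈0 : ∀ {x} → x ≈ 0# → x ^ (q ∸ 1) ≈ 0#
  ^[q-1]≈0 {x} x≈0 = ≡.subst (λ q → x ^ (q ∸ 1) ≈ 0#) 1+#nonzero (^≈0 (𝔽.# nonzero?) #nonzero>0)
    where
    ^≈0 : ∀ k → 0 ℕ.< k → x ^ k ≈ 0#
    ^≈0 (suc k) _ = trans (*-congʳ x≈0) (zeroˡ (x ^ k))

  private
    module ∏ = MonoidSum *-commutativeMonoid

    ∏-^ : ∀ {n} x (k : Vector ℕ n) → ∏.sum (λ i → x ^ k i) ≈ x ^ sumℕ k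
    ∏-^ {zero}  x k = refl
    ∏-^ {suc n} x k = trans (*-congˡ (∏-^ x (k ∘ suc))) (sym (^-homo-* x (k zero) (sumℕ (k ∘ suc))))

    ∏-nonzero : ∀ {n} (t : Vector Carrier n) → (∀ i → ¬ t i ≈ 0#) → ¬ ∏.sum t ≈ 0#
    ∏-nonzero {zero}  t t≉0 1≈0 = 0≉1 (sym 1≈0)
    ∏-nonzero {suc n} t t≉0     = *-nonzero (t≉0 zero) (∏-nonzero (t ∘ suc) (t≉0 ∘ suc))

  -- Multiplication by x permutes the nonzero elements, so their product equals x ^ (q ∸ 1) times itself.
  fermat : ∀ {x} → ¬ x ≈ 0# → x ^ (q ∸ 1) ≈ 1#
  fermat {x} x≉0 = *-cancelˡ-nonzero (∏-nonzero (λ i → φ (Inverse.from finite i)) (λ i → φ-nonzero (Inverse.from finite i))) (begin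
    ∏ φ * x ^ (q ∸ 1)                          ≈⟨ *-comm _ _ ⟩
    x ^ (q ∸ 1) * ∏ φ                          ≡⟨ ≡.cong (λ k → x ^ (k ∸ 1) * ∏ φ) 1+#nonzero ⟨
    x ^ 𝔽.# nonzero? * ∏ φ                     ≈⟨ *-congʳ (∏-^ {q} x _) ⟨
    ∏ (λ y → x ^ [ nonzero? y ]) * ∏ φ         ≈⟨ ∏.∑-distrib-+ {q} _ _ ⟨
    ∏ (λ y → x ^ [ nonzero? y ] * φ y)         ≈⟨ ∏.sum-cong-≋ {q} (λ i → φ-scale (Inverse.from finite i)) ⟨
    ∏ (λ y → φ (x * y))                        ≈⟨ ∑-reindex (x *_) (x⁻¹ *_) *-congˡ *-congˡ
                                                    (cancel (trans (*-comm x x⁻¹) x⁻¹x≈1)) (cancel x⁻¹x≈1) φ φ-cong ⟨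
    ∏ φ                                        ≈⟨ *-identityʳ _ ⟨
    ∏ φ * 1#                                   ∎)
    where
    open 𝔽.Sums *-commutativeMonoid renaming (∑ to ∏)
    x⁻¹    = proj₁ (inverse x x≉0)
    x⁻¹x≈1 = proj₁ (proj₂ (inverse x x≉0))
    cancel : ∀ {a b} → a * b ≈ 1# → ∀ y → a * (b * y) ≈ y
    cancel {a} {b} ab≈1 y = trans (sym (*-assoc a b y)) (trans (*-congʳ ab≈1) (*-identityˡ y))
    -- This exponent turns the factor 0 into 1, so that the product can run over the whole field.
    φ : Carrier → Carrier
    φ y = y ^ [ nonzero? y ]
    φ-cong : ∀ {y z} → y ≈ z → φ y ≈ φ z
    φ-cong {y} {z} y≈z = ^-cong y≈z ([]-cong (nonzero? y) (nonzero? z)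
      (λ y≉0 z≈0 → y≉0 (trans y≈z z≈0)) (λ z≉0 y≈0 → z≉0 (trans (sym y≈z) y≈0)))
    φ-nonzero : ∀ y → ¬ φ y ≈ 0#
    φ-nonzero y with y ≟ 0#
    ... | yes y≈0 rewrite []-no (nonzero? y) (λ y≉0 → y≉0 y≈0) = λ 1≈0 → 0≉1 (sym 1≈0)
    ... | no  y≉0 rewrite []-yes (nonzero? y) y≉0 = *-nonzero y≉0 (λ 1≈0 → 0≉1 (sym 1≈0))
    φ-scale : ∀ y → φ (x * y) ≈ x ^ [ nonzero? y ] * φ y
    φ-scale y = begin
      (x * y) ^ [ nonzero? (x * y) ]               ≡⟨ ≡.cong ((x * y) ^_) ([]-cong (nonzero? (x * y)) (nonzero? y)
                                                        (λ xy≉0 y≈0 → xy≉0 (trans (*-congˡ y≈0) (zeroʳ x))) (*-nonzero x≉0)) ⟩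
      (x * y) ^ [ nonzero? y ]                     ≈⟨ ^-distrib-* x y [ nonzero? y ] ⟩
      x ^ [ nonzero? y ] * y ^ [ nonzero? y ]      ∎

  -- With the value of a linear form for `x`, this is the indicator of the points off a hyperplane:
  -- it turns incidences into polynomials.
  fermat-indicator : ∀ x → x ^ (q ∸ 1) ≈ [ nonzero? x ] ×′ 1#
  fermat-indicator x with x ≟ 0#
  ... | no  x≉0 rewrite []-yes (nonzero? x) x≉0 = trans (fermat x≉0) (sym (+-identityʳ 1#))
  ... | yes x≈0 rewrite []-no (nonzero? x) (λ x≉0 → x≉0 x≈0) = ^[q-1]≈0 x≈0

  sum-×1 : ∀ {m} (t : Vector ℕ m) → sum (λ i → t i ×′ 1#) ≈ sumℕ t ×′ 1#
  sum-×1 {zero}  t = refl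
  sum-×1 {suc m} t = trans (+-congˡ (sum-×1 (t ∘ suc))) (sym (×-homo-+ 1# (t zero) (sumℕ (t ∘ suc))))

  -- The vanishing of p times `1#` is a hypothesis, so that the module applies both to a field with
  -- p elements and to one whose order is a power of p.
  module Characteristic {p} (p-prime : Prime p) (p×1≈0 : p ×′ 1# ≈ 0#) where

    ∣⇒×1≈0 : ∀ {k} → p ∣ k → k ×′ 1# ≈ 0#
    ∣⇒×1≈0 (divides d ≡.refl) = begin
      (d ℕ.* p) ×′ 1#         ≈⟨ ×1-homo-* d p ⟩
      (d ×′ 1#) * (p ×′ 1#)    ≈⟨ *-congˡ p×1≈0 ⟩
      (d ×′ 1#) * 0#          ≈⟨ zeroʳ _ ⟩
      0#                     ∎

    -- If p does not divide k, the two are coprime, and a Bézout identity between their multiples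
    -- makes `1#` equal to `0#`. The two cases at the end are the two signs of that identity.
    ×1≈0⇒∣ : ∀ k → k ×′ 1# ≈ 0# → p ∣ k
    ×1≈0⇒∣ k k×1≈0 with p ∣.∣? k
    ... | yes p∣k = p∣k
    ... | no  p∤k = contradiction 1≈0 (λ 1≈0 → 0≉1 (sym 1≈0))
      where
      one : ∀ a b x y → suc (x ℕ.* a) ≡ y ℕ.* b → a ×′ 1# ≈ 0# → b ×′ 1# ≈ 0# → 1# ≈ 0#
      one a b x y eq a×1≈0 b×1≈0 = begin
        1#                           ≈⟨ +-identityʳ 1# ⟨
        1# + 0#                      ≈⟨ +-congˡ (zeroʳ (x ×′ 1#)) ⟨
        1# + (x ×′ 1#) * 0#           ≈⟨ +-congˡ (*-congˡ a×1≈0) ⟨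
        1# + (x ×′ 1#) * (a ×′ 1#)     ≈⟨ +-congˡ (×1-homo-* x a) ⟨
        suc (x ℕ.* a) ×′ 1#           ≡⟨ ≡.cong (_×′ 1#) eq ⟩
        (y ℕ.* b) ×′ 1#               ≈⟨ ×1-homo-* y b ⟩
        (y ×′ 1#) * (b ×′ 1#)          ≈⟨ *-congˡ b×1≈0 ⟩
        (y ×′ 1#) * 0#                ≈⟨ zeroʳ _ ⟩
        0#                           ∎
      coprime : Coprime k p
      coprime (d∣k , d∣p) with prime⇒irreducible p-prime d∣p
      ... | inj₁ d≡1    = d≡1
      ... | inj₂ ≡.refl = contradiction d∣k p∤k
      1≈0 : 1# ≈ 0#
      1≈0 with Coprime.coprime-Bézout (coprime)
      ... | Bézout.+- x y eq = one p k y x eq p×1≈0 k×1≈0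
      ... | Bézout.-+ x y eq = one k p x y eq k×1≈0 p×1≈0

    ×1-injective-≤ : ∀ {i j} → i ℕ.≤ j → j ℕ.< p → i ×′ 1# ≈ j ×′ 1# → i ≡ j
    ×1-injective-≤ {i} {j} i≤j j<p eq with j ∸ i in j∸i≡ | ×1≈0⇒∣ (j ∸ i) (+-cancelˡ (i ×′ 1#) _ _ (begin
      i ×′ 1# + (j ∸ i) ×′ 1#    ≈⟨ ×-homo-+ 1# i (j ∸ i) ⟨
      (i ℕ.+ (j ∸ i)) ×′ 1#     ≡⟨ ≡.cong (_×′ 1#) (ℕ.m+[n∸m]≡n i≤j) ⟩
      j ×′ 1#                   ≈⟨ eq ⟨
      i ×′ 1#                   ≈⟨ +-identityʳ _ ⟨
      i ×′ 1# + 0#              ∎))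
    ... | zero  | _   = ℕ.≤-antisym i≤j (ℕ.m∸n≡0⇒m≤n j∸i≡)
    ... | suc k | p∣k = contradiction
      (ℕ.≤-trans (∣.∣⇒≤ p∣k) (ℕ.≤-trans (ℕ.≤-reflexive (≡.sym j∸i≡)) (ℕ.m∸n≤m j i))) (ℕ.<⇒≱ j<p)

    ×1-injective : ∀ {i j} → i ℕ.< p → j ℕ.< p → i ×′ 1# ≈ j ×′ 1# → i ≡ j
    ×1-injective {i} {j} i<p j<p eq with ℕ.≤-total i j
    ... | inj₁ i≤j = ×1-injective-≤ i≤j j<p eq
    ... | inj₂ j≤i = ≡.sym (×1-injective-≤ j≤i i<p (sym eq))

  -- The multiples of `1#` by the numbers below q are distinct, hence exhaust the field. Elements of
  -- a prime field can thus be written as natural numbers and read in another field.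
  ×1-surjective : Prime q → ∀ x → ∃[ k ] x ≈ k ×′ 1#
  ×1-surjective q-prime x =
    let i , fi≡ = injective⇒surjective {f = λ i → 𝔽.index (toℕ i ×′ 1#)}
                    (λ {i} {j} eq → Fin.toℕ-injective (×1-injective (Fin.toℕ<n i) (Fin.toℕ<n j)
                      (index-injective eq)))
                    (𝔽.index x)
    in toℕ i , sym (index-injective fi≡)
    where
    open Characteristic q-prime ×1≈0
    index-injective : ∀ {x y} → 𝔽.index x ≡ 𝔽.index y → x ≈ y
    index-injective eq = trans (sym (𝔽.element-index _)) (trans (reflexive (≡.cong 𝔽.element eq)) (𝔽.element-index _))

  -- The image of p ^ h is the h-th power of the image of p, and zero is the only nilpotent element
  -- of a field.
  prime-characteristic : ∀ {p} h → q ≡ p ℕ.^ h → p ×′ 1# ≈ 0#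
  prime-characteristic {p} h q≡p^h = ^≈0⇒≈0 h (trans (sym (×1-homo-^ h)) (trans (reflexive (≡.cong (_×′ 1#) (≡.sym q≡p^h))) ×1≈0))
    where
    ×1-homo-^ : ∀ h → (p ℕ.^ h) ×′ 1# ≈ (p ×′ 1#) ^ h
    ×1-homo-^ zero    = +-identityʳ 1#
    ×1-homo-^ (suc h) = trans (×1-homo-* p (p ℕ.^ h)) (*-congˡ (×1-homo-^ h))
    ^≈0⇒≈0 : ∀ {x} h → x ^ h ≈ 0# → x ≈ 0#
    ^≈0⇒≈0 zero    1≈0    = contradiction (sym 1≈0) 0≉1
    ^≈0⇒≈0 (suc h) x*xʰ≈0 with no-zero-divisors x*xʰ≈0
    ... | inj₁ x≈0  = x≈0
    ... | inj₂ xʰ≈0 = ^≈0⇒≈0 h xʰ≈0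

-- Vectors and linear forms

funToFin-cong : ∀ {m n} {f g : Fin m → Fin n} → (∀ i → f i ≡ g i) → funToFin f ≡ funToFin g
funToFin-cong {zero}  f≗g = ≡.refl
funToFin-cong {suc m} f≗g = ≡.cong₂ combine (f≗g zero) (funToFin-cong (f≗g ∘ suc))

module Vectors {c ℓ q} (F : FiniteField c ℓ q) where
  open FiniteField F hiding (zero)
  open FieldProperties F
  open import Relation.Binary.Reasoning.Setoid setoid

  infixl 6 _+ᵛ_
  infixr 7 _*ᵛ_

  _+ᵛ_ : ∀ {m} → Vector Carrier m → Vector Carrier m → Vector Carrier m
  (u +ᵛ v) i = u i + v i

  _*ᵛ_ : ∀ {m} → Carrier → Vector Carrier m → Vector Carrier m
  (s *ᵛ v) i = s * v i

  -ᵛ_ : ∀ {m} → Vector Carrier m → Vector Carrier m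
  (-ᵛ v) i = - v i

  ≋-setoid : ℕ → Setoid c ℓ
  ≋-setoid m = record
    { Carrier       = Vector Carrier m
    ; _≈_           = _≋_
    ; isEquivalence = record
      { refl  = λ i → refl
      ; sym   = λ u≋v i → sym (u≋v i)
      ; trans = λ u≋v v≋w i → trans (u≋v i) (v≋w i)
      }
    }

  vector-finite : ∀ m → Inverse (≋-setoid m) (≡.setoid (Fin (q ℕ.^ m)))
  vector-finite m = record
    { to        = to
    ; from      = from
    ; to-cong   = λ u≋v → funToFin-cong (λ i → Inverse.to-cong finite (u≋v i))
    ; from-cong = λ { ≡.refl i → refl }
    ; inverse   = (λ {k} v≋ → ≡.trans (funToFin-cong (λ i → ≡.trans (Inverse.to-cong finite (v≋ i)) (𝔽.index-element _)))
                                  (Fin.funToFin-finToFin {m} {q} k))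
                , (λ {v} k≡ i → trans (reflexive (≡.cong (λ k → from k i) k≡))
                    (trans (Inverse.from-cong finite (Fin.finToFun-funToFin (𝔽.index ∘ v) i)) (𝔽.element-index (v i))))
    }
    where
    to : Vector Carrier m → Fin (q ℕ.^ m)
    to v = funToFin (𝔽.index ∘ v)
    from : Fin (q ℕ.^ m) → Vector Carrier m
    from k i = 𝔽.element (finToFun {q} {m} k i)

  module 𝕍 {m : ℕ} where
    open Enumeration (vector-finite m) public
    open Inverse (vector-finite m) public using () renaming (to to index; from to element)

  ·-congˡ : ∀ {m} (h : Vector Carrier m) {x y} → x ≋ y → h · x ≈ h · y
  ·-congˡ h x≋y = sum-cong-≋ (λ i → *-congˡ (x≋y i))

  ·-+ : ∀ {m} (h x y : Vector Carrier m) → h · (x +ᵛ y) ≈ h · x + h · y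
  ·-+ {m} h x y = trans (sum-cong-≋ {m} (λ i → distribˡ (h i) (x i) (y i))) (∑-distrib-+ {m} _ _)

  ·-* : ∀ {m} (h : Vector Carrier m) s x → h · (s *ᵛ x) ≈ s * (h · x)
  ·-* {m} h s x = trans
    (sum-cong-≋ {m} (λ i → x∙yz≈y∙xz (h i) s (x i)))
    (sym (*-distribˡ-sum {m} s _))
    where open CommutativeSemigroupProperties *-commutativeSemigroup

  *-· : ∀ {m} s (h x : Vector Carrier m) → (s *ᵛ h) · x ≈ s * (h · x)
  *-· {m} s h x = trans
    (sum-cong-≋ {m} (λ i → *-assoc s (h i) (x i)))
    (sym (*-distribˡ-sum {m} s _))

  ·-0 : ∀ {m} (h : Vector Carrier m) → h · 0ᵛ ≈ 0#
  ·-0 {m} h = trans (sum-cong-≋ {m} (λ i → zeroʳ (h i))) (sum-replicate-zero m)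

  unit : ∀ {m} → Fin m → Vector Carrier m
  unit i j = if does (i Fin.≟ j) then 1# else 0#

  ·-unit : ∀ {m} (h : Vector Carrier m) i → h · unit i ≈ h i
  ·-unit h i = trans (sum-single +-commutativeMonoid (λ j → h j * unit i j) i off-diagonal) diagonal
    where
    off-diagonal : ∀ j → j ≢ i → h j * unit i j ≈ 0#
    off-diagonal j j≢i with i Fin.≟ j
    ... | yes i≡j = contradiction (≡.sym i≡j) j≢i
    ... | no  _   = zeroʳ (h j)
    diagonal : h i * unit i i ≈ h i
    diagonal with i Fin.≟ i
    ... | yes _   = *-identityʳ (h i)
    ... | no  i≢i = contradiction ≡.refl i≢i

  module _ {m : ℕ} where
    translate : ∀ v (φ : Vector Carrier m → ℕ) → (∀ {x y} → x ≋ y → φ x ≡ φ y) →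
                𝕍.∑ φ ≡ 𝕍.∑ (λ x → φ (x +ᵛ v))
    translate v = 𝕍.∑-reindex (_+ᵛ v) (_+ᵛ (-ᵛ v))
      (λ x≋y i → +-congʳ (x≋y i)) (λ x≋y i → +-congʳ (x≋y i))
      (λ x i → //-rightDividesˡ (v i) (x i)) (λ x i → //-rightDividesʳ (v i) (x i))

    -- Translation by s e preserves Q and adds s to h, so all fibres of h on Q have the same size.
    equidistribution :
      ∀ {r} {Q : Pred (Vector Carrier m) r} (Q? : Decidable Q) → Q Respects _≋_ →
      ∀ h e → h · e ≈ 1# → (∀ s {x} → Q x → Q (x +ᵛ s *ᵛ e)) →
      q ℕ.* 𝕍.# (λ x → Q? x ×-dec (h · x ≟ 0#)) ≡ 𝕍.# Q?
    equidistribution {Q = Q} Q? Q-resp h e he≈1 Q-shift = ≡-Reasoning.begin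
      q ℕ.* 𝕍.# (λ x → Q? x ×-dec (h · x ≟ 0#))                ≡-Reasoning.≡⟨ 𝔽.∑-const _ ⟨
      𝔽.∑ (λ s → 𝕍.# (λ x → Q? x ×-dec (h · x ≟ 0#)))          ≡-Reasoning.≡⟨ 𝔽.∑-cong shift ⟩
      𝔽.∑ (λ s → 𝕍.∑ (λ x → [ Q? x ] ℕ.* [ s ≟ h · x ]))        ≡-Reasoning.≡⟨ ∑-swap finite (vector-finite m) (λ s x → [ Q? x ] ℕ.* [ s ≟ h · x ]) ⟩
      𝕍.∑ (λ x → 𝔽.∑ (λ s → [ Q? x ] ℕ.* [ s ≟ h · x ]))        ≡-Reasoning.≡⟨ 𝕍.∑-cong one-value ⟩
      𝕍.# Q?                                                   ≡-Reasoning.∎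
      where
      module ≡-Reasoning = ≡.≡-Reasoning
      one-value : ∀ x → 𝔽.∑ (λ s → [ Q? x ] ℕ.* [ s ≟ h · x ]) ≡ [ Q? x ]
      one-value x = ≡.trans (𝔽.∑-*ˡ [ Q? x ] (λ s → [ s ≟ h · x ])) (≡.trans
        (≡.cong ([ Q? x ] ℕ.*_) (𝔽.#≡1 (_≟ (h · x)) (λ s≈t s≈ → trans (sym s≈t) s≈) (λ s≈ t≈ → trans s≈ (sym t≈)) (h · x) refl))
        (ℕ.*-identityʳ _))
      h-shift : ∀ s x → h · (x +ᵛ s *ᵛ e) ≈ h · x + s
      h-shift s x = begin
        h · (x +ᵛ s *ᵛ e)       ≈⟨ ·-+ h x (s *ᵛ e) ⟩
        h · x + h · (s *ᵛ e)    ≈⟨ +-congˡ (·-* h s e) ⟩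
        h · x + s * (h · e)     ≈⟨ +-congˡ (trans (*-congˡ he≈1) (*-identityʳ s)) ⟩
        h · x + s               ∎
      unshift : ∀ s {x} → Q (x +ᵛ s *ᵛ e) → Q x
      unshift s {x} Qx+se = Q-resp
        (λ i → trans (+-congˡ (sym (-‿distribˡ-* s (e i)))) (//-rightDividesʳ (s * e i) (x i)))
        (Q-shift (- s) Qx+se)
      shift : ∀ s → 𝕍.# (λ x → Q? x ×-dec (h · x ≟ 0#)) ≡ 𝕍.∑ (λ x → [ Q? x ] ℕ.* [ s ≟ h · x ])
      shift s = ≡.sym (≡.trans (translate (s *ᵛ e) (λ x → [ Q? x ] ℕ.* [ s ≟ h · x ])
        (λ {x} {y} x≋y → ≡.cong₂ ℕ._*_
          ([]-cong (Q? x) (Q? y) (Q-resp x≋y) (Q-resp (λ i → sym (x≋y i))))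
          ([]-cong (s ≟ h · x) (s ≟ h · y) (λ s≈ → trans s≈ (·-congˡ h x≋y)) (λ s≈ → trans s≈ (sym (·-congˡ h x≋y))))))
        (𝕍.∑-cong (λ x → ≡.trans
          (≡.cong₂ ℕ._*_
            ([]-cong (Q? (x +ᵛ s *ᵛ e)) (Q? x) (unshift s) (Q-shift s))
            ([]-cong (s ≟ h · (x +ᵛ s *ᵛ e)) (h · x ≟ 0#)
              (λ s≈ → +-identityˡ-unique _ s (sym (trans s≈ (h-shift s x))))
              (λ hx≈0 → sym (trans (h-shift s x) (trans (+-congʳ hx≈0) (+-identityˡ s))))))
          (≡.sym ([]-× (Q? x) (h · x ≟ 0#))))))

    nonzero-form : ∀ h → ¬ (h ≋ 0ᵛ {m}) → ∃[ e ] h · e ≈ 1#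
    nonzero-form h h≉0 =
      let i , hᵢ≉0       = Fin.¬∀⟶∃¬ m _ (λ i → h i ≟ 0#) h≉0
          s , s*hᵢ≈1 , _ = inverse (h i) hᵢ≉0
      in s *ᵛ unit i , trans (·-* h s (unit i)) (trans (*-congˡ (·-unit h i)) s*hᵢ≈1)

    Proportional : Vector Carrier m → Vector Carrier m → Set _
    Proportional g h = ∃[ s ] ¬ s ≈ 0# × (∀ i → g i ≈ s * h i)

    -- With `g · e ≈ 1#`, the vectors `x i`, that is `unit i` minus g i times e, lie in the kernel
    -- of g. Were h zero on all of them, it would be h · e times g. So h is nonzero on one of them,
    -- which is then rescaled.
    separating-vector : ∀ g h → ¬ (g ≋ 0ᵛ) → ¬ (h ≋ 0ᵛ) → ¬ Proportional h g →
                        ∃[ e ] (g · e ≈ 0# × h · e ≈ 1#)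
    separating-vector g h g≉0 h≉0 h≁g = 
      let i , hx≉0        = Fin.¬∀⟶∃¬ m _ (λ i → h · x i ≟ 0#) (λ hx≈0 → h≁g (h · e , he≉0 hx≈0 , h≈he*g hx≈0))
          s , s*hx≈1 , _  = inverse (h · x i) hx≉0
      in s *ᵛ x i , trans (·-* g s (x i)) (trans (*-congˡ (gx≈0 i)) (zeroʳ s)) , trans (·-* h s (x i)) s*hx≈1
      where
      e     = proj₁ (nonzero-form g g≉0)
      ge≈1  = proj₂ (nonzero-form g g≉0)
      x : Fin m → Vector Carrier m
      x i = unit i +ᵛ (- g i) *ᵛ e
      ·x : ∀ k i → k · x i ≈ k i + - g i * (k · e)
      ·x k i = trans (·-+ k (unit i) _) (+-cong (·-unit k i) (·-* k (- g i) e))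
      gx≈0 : ∀ i → g · x i ≈ 0#
      gx≈0 i = trans (·x g i) (trans (+-congˡ (trans (*-congˡ ge≈1) (*-identityʳ (- g i)))) (-‿inverseʳ (g i)))
      h≈he*g : (∀ i → h · x i ≈ 0#) → ∀ i → h i ≈ (h · e) * g i
      h≈he*g hx≈0 i = trans (x∙y⁻¹≈ε⇒x≈y _ _ (trans (+-congˡ (-‿distribˡ-* (g i) (h · e))) (trans (sym (·x h i)) (hx≈0 i))))
        (*-comm (g i) (h · e))
      he≉0 : (∀ i → h · x i ≈ 0#) → ¬ h · e ≈ 0#
      he≉0 hx≈0 he≈0 = h≉0 (λ i → trans (h≈he*g hx≈0 i) (trans (*-congʳ he≈0) (zeroˡ (g i))))

  module _ {n : ℕ} where

    #kernel : ∀ (h : Vector Carrier (suc n)) → ¬ (h ≋ 0ᵛ) → 𝕍.# (λ x → h · x ≟ 0#) ≡ q ℕ.^ n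
    #kernel h h≉0 = ℕ.*-cancelˡ-≡ _ _ q {{q≢0}} (≡.trans
      (≡.cong (q ℕ.*_) (𝕍.∑-cong (λ x → []-cong (h · x ≟ 0#) ((yes tt) ×-dec (h · x ≟ 0#)) (tt ,_) proj₂)))
      (≡.trans (equidistribution (λ _ → yes tt) (λ _ → id) h (proj₁ e) (proj₂ e) (λ _ → id))
        (≡.trans (𝕍.∑-const {suc n} 1) (ℕ.*-identityʳ _))))
      where
      e = nonzero-form h h≉0

    -- Equidistribution of `h` on the kernel of `g`, along a direction inside that kernel. The
    -- factor q on the left avoids the exponent n - 1.
    #kernel₂ : ∀ (g h : Vector Carrier (suc n)) → ¬ (g ≋ 0ᵛ) → ¬ (h ≋ 0ᵛ) → ¬ Proportional h g →
               q ℕ.* 𝕍.# (λ x → (g · x ≟ 0#) ×-dec (h · x ≟ 0#)) ≡ q ℕ.^ n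
    #kernel₂ g h g≉0 h≉0 h≁g = ≡.trans
      (equidistribution (λ x → g · x ≟ 0#) (λ x≋y gx≈0 → trans (sym (·-congˡ g x≋y)) gx≈0) h e he≈1
        (λ s {x} gx≈0 → begin
          g · (x +ᵛ s *ᵛ e)     ≈⟨ ·-+ g x (s *ᵛ e) ⟩
          g · x + g · (s *ᵛ e)  ≈⟨ +-cong gx≈0 (trans (·-* g s e) (trans (*-congˡ ge≈0) (zeroʳ s))) ⟩
          0# + 0#               ≈⟨ +-identityʳ 0# ⟩
          0#                    ∎))
      (#kernel g g≉0)
      where
      separating = separating-vector g h g≉0 h≉0 h≁g
      e    = proj₁ separating
      ge≈0 = proj₁ (proj₂ separating)
      he≈1 = proj₂ (proj₂ separating)

-- Points of the projective space

AllPairs-lookup : ∀ {a r} {A : Set a} {R : Rel A r} → Symmetric R → ∀ {xs} → AllPairs R xs →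
                  ∀ i j → i ≢ j → R (List.lookup xs i) (List.lookup xs j)
AllPairs-lookup sym (_   ∷ _)   zero    zero    i≢j = contradiction ≡.refl i≢j
AllPairs-lookup sym (Rx  ∷ _)   zero    (suc j) i≢j = All.lookup Rx (∈-lookup j)
AllPairs-lookup sym (Rx  ∷ _)   (suc i) zero    i≢j = sym (All.lookup Rx (∈-lookup i))
AllPairs-lookup sym (_   ∷ Rxs) (suc i) (suc j) i≢j = AllPairs-lookup sym Rxs i j (i≢j ∘ ≡.cong suc)

∣tabulate∣ : ∀ {n p} {P : Pred (Fin n) p} (P? : Decidable P) → ∣ Vec.tabulate (does ∘ P?) ∣ ≡ sumℕ (λ i → [ P? i ])
∣tabulate∣ {zero}  P? = ≡.refl
∣tabulate∣ {suc n} P? with does (P? zero)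
... | true  = ≡.cong suc (∣tabulate∣ (P? ∘ suc))
... | false = ∣tabulate∣ (P? ∘ suc)

module Points {c ℓ q} (F : FiniteField c ℓ q) (n : ℕ) where
  open FiniteField F hiding (zero)
  open FieldProperties F
  open Vectors F
  open ProjectiveSpace F n

  module ℙ = Enumeration (Identity.inverse (≡.setoid (Fin θ)))

  ∼-refl : ∀ {x} → x ∼ x
  ∼-refl = 1# , 0≉1 ∘ sym , λ i → sym (*-identityˡ _)

  ∼-sym : ∀ {x y} → x ∼ y → y ∼ x
  ∼-sym (s , s≉0 , x≈sy) = let t , ts≈1 , t≉0 = inverse s s≉0 in
    t , t≉0 , λ i → trans (sym (*-identityˡ _)) (trans (*-congʳ (sym ts≈1)) (trans (*-assoc t s _) (*-congˡ (sym (x≈sy i)))))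

  ∼-trans : ∀ {x y z} → x ∼ y → y ∼ z → x ∼ z
  ∼-trans (s , s≉0 , x≈sy) (t , t≉0 , y≈tz) =
    s * t , *-nonzero s≉0 t≉0 , λ i → trans (x≈sy i) (trans (*-congˡ (y≈tz i)) (sym (*-assoc s t _)))

  ≋⇒∼ : ∀ {x y} → x ≋ y → x ∼ y
  ≋⇒∼ x≋y = 1# , 0≉1 ∘ sym , λ i → trans (x≋y i) (sym (*-identityˡ _))

  ∼-decSetoid : DecSetoid c (c ⊔ ℓ)
  ∼-decSetoid = record
    { Carrier = Coordinates
    ; _≈_ = _∼_
    ; isDecEquivalence = record
      { isEquivalence = record { refl = ∼-refl ; sym = ∼-sym ; trans = ∼-trans }
      ; _≟_ = _∼?_
      }
    }

  vectors-complete : ∀ {m} (x : Vector Carrier m) → Any (x ≋_) (vectors m)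
  vectors-complete {zero}  x = here (λ ())
  vectors-complete {suc m} x = Any.cartesianProductWith⁺ _
    (λ { x₀≈ xₛ≋ zero → x₀≈ ; x₀≈ xₛ≋ (suc i) → xₛ≋ i })
    (Any.map⁺ {P = x zero ≈_} (Any.tabulate⁺ (𝔽.index (x zero)) (sym (𝔽.element-index (x zero)))))
    (vectors-complete (x ∘ suc))

  representative : ∀ x → ¬ (x ≋ 0ᵛ) → ∃[ P ] x ∼ homogeneous P
  representative x x≉0 = Any.index x∈ , Any.lookup-index x∈
    where
    nonzeroᵛ? : Decidable (λ y → ¬ (y ≋ 0ᵛ))
    nonzeroᵛ? y = ¬? (y ≋? 0ᵛ)
    x∈nonzero : Any (x ∼_) (List.filter nonzeroᵛ? (vectors (suc n)))
    x∈nonzero with Any.filter⁺ nonzeroᵛ? (vectors-complete x)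
    ... | inj₁ x∈  = Any.map ≋⇒∼ x∈
    ... | inj₂ ¬y≉0 = contradiction
      (λ y≋0 → x≉0 (λ i → trans (Any.lookup-result (vectors-complete x) i) (y≋0 i))) ¬y≉0
    x∈ : Any (x ∼_) representatives
    x∈ = Any.deduplicate⁺ _∼?_ (λ z∼y x∼y → ∼-trans x∼y (∼-sym z∼y)) x∈nonzero

  homogeneous-nonzero : ∀ P → ¬ (homogeneous P ≋ 0ᵛ)
  homogeneous-nonzero P = All.lookup
    (All.deduplicate⁺ _∼?_ (All.all-filter (λ x → ¬? (x ≋? 0ᵛ)) (vectors (suc n)))) (∈-lookup P)

  homogeneous-injective : ∀ {P Q} → homogeneous P ∼ homogeneous Q → P ≡ Q
  homogeneous-injective {P} {Q} P∼Q with P Fin.≟ Q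
  ... | yes P≡Q = P≡Q
  ... | no  P≢Q = contradiction P∼Q (AllPairs-lookup (λ x≁y y∼x → x≁y (∼-sym y∼x))
    (Unique.deduplicate-! ∼-decSetoid (List.filter (λ x → ¬? (x ≋? 0ᵛ)) (vectors (suc n)))) P Q P≢Q)

  -- Pairs of a vector x and a nonzero scalar s with x = s y are counted twice: each multiple of y
  -- has one scalar, read off at a nonzero coordinate of y, and each nonzero scalar has one
  -- multiple.
  #proportional : ∀ y → ¬ (y ≋ 0ᵛ) → 𝕍.# (_∼? y) ≡ 𝔽.# nonzero?
  #proportional y y≉0 = begin
    𝕍.# (_∼? y)                                                   ≡⟨ 𝕍.∑-cong scalars ⟩
    𝕍.∑ (λ x → 𝔽.# (multiple? x))                                 ≡⟨ ∑-swap (vector-finite (suc n)) finite (λ x s → [ multiple? x s ]) ⟩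
    𝔽.∑ (λ s → 𝕍.# (λ x → multiple? x s))                         ≡⟨ 𝔽.∑-cong multiples ⟩
    𝔽.# nonzero?                                                  ∎
    where
    open ≡.≡-Reasoning
    Multiple : Coordinates → Carrier → Set _
    Multiple x s = ¬ (s ≈ 0#) × (x ≋ s *ᵛ y)
    multiple? : ∀ x s → Dec (Multiple x s)
    multiple? x s = nonzero? s ×-dec (x ≋? (s *ᵛ y))
    i    = proj₁ (Fin.¬∀⟶∃¬ _ _ (λ i → y i ≟ 0#) y≉0)
    yᵢ≉0 = proj₂ (Fin.¬∀⟶∃¬ _ _ (λ i → y i ≟ 0#) y≉0)
    scalars : ∀ x → [ x ∼? y ] ≡ 𝔽.# (multiple? x)
    scalars x = by-cases (x ∼? y)
      where
      by-cases : (x∼y? : Dec (x ∼ y)) → [ x∼y? ] ≡ 𝔽.# (multiple? x)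
      by-cases (yes (s , s≉0 , x≈sy)) = ≡.sym (𝔽.#≡1 (multiple? x)
        (λ s≈t (s≉0 , x≈sy) → (λ t≈0 → s≉0 (trans s≈t t≈0)) , λ i → trans (x≈sy i) (*-congʳ s≈t))
        (λ (_ , x≈sy) (_ , x≈ty) → *-cancelˡ-nonzero yᵢ≉0
          (trans (*-comm _ _) (trans (trans (sym (x≈sy i)) (x≈ty i)) (*-comm _ _))))
        s (s≉0 , x≈sy))
      by-cases (no x≁y) = ≡.sym (𝔽.#≡0 (multiple? x) (λ s s-multiple → x≁y (s , s-multiple)))
    multiples : ∀ s → 𝕍.# (λ x → multiple? x s) ≡ [ nonzero? s ]
    multiples s = by-cases (nonzero? s)
      where
      by-cases : (s≉0? : Dec (¬ s ≈ 0#)) → 𝕍.# (λ x → multiple? x s) ≡ [ s≉0? ]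
      by-cases (yes s≉0) = 𝕍.#≡1 (λ x → multiple? x s)
        (λ x≋z (_ , x≈sy) → s≉0 , λ i → trans (sym (x≋z i)) (x≈sy i))
        (λ (_ , x≈sy) (_ , z≈sy) i → trans (x≈sy i) (sym (z≈sy i)))
        (s *ᵛ y) (s≉0 , λ i → refl)
      by-cases (no ¬s≉0) = 𝕍.#≡0 (λ x → multiple? x s) (λ x (s≉0 , _) → ¬s≉0 s≉0)

  -- Every nonzero vector is proportional to exactly one representative, and every representative
  -- has q - 1 nonzero multiples. All counts of points are obtained from counts of vectors in this
  -- way.
  #vectors≡[q-1]#points :
    ∀ {r} {Q : Pred Coordinates r} (Q? : Decidable Q) → Q Respects _∼_ → (∀ {x} → Q x → ¬ (x ≋ 0ᵛ)) →
    𝕍.# Q? ≡ 𝔽.# nonzero? ℕ.* ℙ.# (λ P → Q? (homogeneous P))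
  #vectors≡[q-1]#points {Q = Q} Q? Q-resp Q⇒≉0 = begin
    𝕍.# Q?                                                        ≡⟨ 𝕍.∑-cong unique-point ⟩
    𝕍.∑ (λ x → ℙ.∑ (λ P → [ Q? (homogeneous P) ] ℕ.* [ x ∼? homogeneous P ]))
      ≡⟨ ∑-swap (vector-finite (suc n)) (Identity.inverse (≡.setoid (Fin θ))) (λ x P → [ Q? (homogeneous P) ] ℕ.* [ x ∼? homogeneous P ]) ⟩
    ℙ.∑ (λ P → 𝕍.∑ (λ x → [ Q? (homogeneous P) ] ℕ.* [ x ∼? homogeneous P ]))
      ≡⟨ ℙ.∑-cong (λ P → ≡.trans (𝕍.∑-*ˡ [ Q? (homogeneous P) ] (λ x → [ x ∼? homogeneous P ]))
           (≡.cong ([ Q? (homogeneous P) ] ℕ.*_) (#proportional (homogeneous P) (homogeneous-nonzero P)))) ⟩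
    ℙ.∑ (λ P → [ Q? (homogeneous P) ] ℕ.* 𝔽.# nonzero?)           ≡⟨ ℙ.∑-*ʳ (𝔽.# nonzero?) _ ⟩
    ℙ.# (λ P → Q? (homogeneous P)) ℕ.* 𝔽.# nonzero?               ≡⟨ ℕ.*-comm _ (𝔽.# nonzero?) ⟩
    𝔽.# nonzero? ℕ.* ℙ.# (λ P → Q? (homogeneous P))               ∎
    where
    open ≡.≡-Reasoning
    unique-point : ∀ x → [ Q? x ] ≡ ℙ.∑ (λ P → [ Q? (homogeneous P) ] ℕ.* [ x ∼? homogeneous P ])
    unique-point x = ≡.trans (by-cases (Q? x)) (ℙ.∑-cong (λ P → []-× (Q? (homogeneous P)) (x ∼? homogeneous P)))
      where
      by-cases : (Qx? : Dec (Q x)) → [ Qx? ] ≡ ℙ.# (λ P → Q? (homogeneous P) ×-dec (x ∼? homogeneous P))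
      by-cases (yes Qx) = let P , x∼P = representative x (Q⇒≉0 Qx) in
        ≡.sym (ℙ.#≡1 (λ P → Q? (homogeneous P) ×-dec (x ∼? homogeneous P)) (λ { ≡.refl → id })
          (λ (_ , x∼P) (_ , x∼P′) → homogeneous-injective (∼-trans (∼-sym x∼P) x∼P′)) P (Q-resp x∼P Qx , x∼P))
      by-cases (no ¬Qx) = ≡.sym (ℙ.#≡0 (λ P → Q? (homogeneous P) ×-dec (x ∼? homogeneous P))
        (λ P (QP , x∼P) → ¬Qx (Q-resp (∼-sym x∼P) QP)))

-- Polynomial functions and forms

module Polynomials {c ℓ q} (F : FiniteField c ℓ q) where
  open FiniteField F hiding (zero)
  open FieldProperties F
  open import Algebra.Solver.Ring.NaturalCoefficients.Default commutativeSemiring using (solve; _:=_; _:+_; _:*_)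
  open import Relation.Binary.Reasoning.Setoid setoid

  -- φ is a polynomial function of degree at most d in which t ^ d has coefficient a; the divided
  -- differences of φ, rather than its coefficients, are the witnesses.
  Polynomial : ℕ → (Carrier → Carrier) → Carrier → Set (c ⊔ ℓ)
  Polynomial zero    φ a = ∀ t → φ t ≈ a
  Polynomial (suc d) φ a = ∀ r → ∃[ ψ ] Polynomial d ψ a × (∀ t → φ t ≈ φ r + (t - r) * ψ t)

  Polynomial-cong : ∀ d {φ ψ a b} → (∀ t → φ t ≈ ψ t) → a ≈ b → Polynomial d φ a → Polynomial d ψ b
  Polynomial-cong zero    φ≈ψ a≈b P t = trans (sym (φ≈ψ t)) (trans (P t) a≈b)
  Polynomial-cong (suc d) φ≈ψ a≈b P r = let χ , Q , φ≈ = P r in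
    χ , Polynomial-cong d (λ _ → refl) a≈b Q , λ t → trans (sym (φ≈ψ t)) (trans (φ≈ t) (+-congʳ (φ≈ψ r)))

  Polynomial-0 : ∀ d → Polynomial d (λ _ → 0#) 0#
  Polynomial-0 zero    t = refl
  Polynomial-0 (suc d) r = (λ _ → 0#) , Polynomial-0 d , λ t → sym (trans (+-congˡ (zeroʳ (t - r))) (+-identityʳ 0#))

  Polynomial-raise : ∀ d {φ a} → Polynomial d φ a → Polynomial (suc d) φ 0#
  Polynomial-raise zero    P r = (λ _ → 0#) , (λ _ → refl) ,
    λ t → trans (P t) (sym (trans (+-cong (P r) (zeroʳ (t - r))) (+-identityʳ _)))
  Polynomial-raise (suc d) P r = let χ , Q , φ≈ = P r in χ , Polynomial-raise d Q , φ≈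

  Polynomial-+ : ∀ d {φ ψ a b} → Polynomial d φ a → Polynomial d ψ b → Polynomial d (λ t → φ t + ψ t) (a + b)
  Polynomial-+ zero    P Q t = +-cong (P t) (Q t)
  Polynomial-+ (suc d) P Q r =
    let χ , P′ , φ≈ = P r
        ω , Q′ , ψ≈ = Q r
    in (λ t → χ t + ω t) , Polynomial-+ d P′ Q′ , λ t → trans (+-cong (φ≈ t) (ψ≈ t))
         (solve 5 (λ x y u v w → (x :+ u :* v) :+ (y :+ u :* w) := (x :+ y) :+ u :* (v :+ w)) refl _ _ (t - r) (χ t) (ω t))

  Polynomial-* : ∀ d s {φ a} → Polynomial d φ a → Polynomial d (λ t → s * φ t) (s * a)
  Polynomial-* zero    s P t = *-congˡ (P t)
  Polynomial-* (suc d) s P r = let χ , Q , φ≈ = P r in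
    (λ t → s * χ t) , Polynomial-* d s Q , λ t → trans (*-congˡ (φ≈ t))
      (solve 4 (λ s x u v → s :* (x :+ u :* v) := s :* x :+ u :* (s :* v)) refl s _ (t - r) (χ t))

  private
    t≈r+[t-r] : ∀ t r → t ≈ r + (t - r)
    t≈r+[t-r] t r = sym (trans (+-comm r (t - r)) (//-rightDividesˡ r t))

  Polynomial-*-linear : ∀ d α β {φ a} → Polynomial d φ a → Polynomial (suc d) (λ t → φ t * (α + t * β)) (a * β)
  Polynomial-*-linear zero    α β {φ} {a} P r = (λ _ → a * β) , (λ _ → refl) , λ t → begin
    φ t * (α + t * β)                    ≈⟨ *-cong (P t) (+-congˡ (*-congʳ (t≈r+[t-r] t r))) ⟩
    a * (α + (r + (t - r)) * β)          ≈⟨ solve 5 (λ a α β r u → a :* (α :+ (r :+ u) :* β) := a :* (α :+ r :* β) :+ u :* (a :* β))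
                                              refl a α β r (t - r) ⟩
    a * (α + r * β) + (t - r) * (a * β)  ≈⟨ +-congʳ (*-congʳ (P r)) ⟨
    φ r * (α + r * β) + (t - r) * (a * β)  ∎
  Polynomial-*-linear (suc d) α β {φ} {a} P r = let χ , Q , φ≈ = P r in
    -- The product rule for divided differences. The constant `φ r * β` adds nothing to the leading
    -- coefficient.
    (λ t → χ t * (α + t * β) + φ r * β) ,
    Polynomial-cong (suc d) (λ _ → refl) (+-identityʳ _)
      (Polynomial-+ (suc d) (Polynomial-*-linear d α β Q) (constant d (φ r * β))) ,
    λ t → begin
      φ t * (α + t * β)                                      ≈⟨ *-congʳ (φ≈ t) ⟩
      (φ r + (t - r) * χ t) * (α + t * β)                    ≈⟨ solve 4 (λ x u y l → (x :+ u :* y) :* l := x :* l :+ u :* (y :* l))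
                                                                  refl (φ r) (t - r) (χ t) (α + t * β) ⟩
      φ r * (α + t * β) + (t - r) * (χ t * (α + t * β))      ≈⟨ +-congʳ (*-congˡ (+-congˡ (*-congʳ (t≈r+[t-r] t r)))) ⟩
      φ r * (α + (r + (t - r)) * β) + (t - r) * (χ t * (α + t * β))
        ≈⟨ solve 6 (λ x α β r u y → x :* (α :+ (r :+ u) :* β) :+ u :* y := x :* (α :+ r :* β) :+ u :* (y :+ x :* β))
             refl (φ r) α β r (t - r) (χ t * (α + t * β)) ⟩
      φ r * (α + r * β) + (t - r) * (χ t * (α + t * β) + φ r * β)  ∎
    where
    constant : ∀ d a → Polynomial (suc d) (λ _ → a) 0#
    constant zero    a = Polynomial-raise 0 (λ _ → refl)
    constant (suc d) a = Polynomial-raise (suc d) (constant d a)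

  -- The difference of the values at s and t has the factor s - t, so the divided differences
  -- already force `φ` to respect equality in the field.
  Polynomial⇒cong : ∀ d {φ a} → Polynomial d φ a → ∀ {s t} → s ≈ t → φ s ≈ φ t
  Polynomial⇒cong zero    P {s} {t} s≈t = trans (P s) (sym (P t))
  Polynomial⇒cong (suc d) P {s} {t} s≈t = let χ , _ , φ≈ = P t in
    trans (φ≈ s) (trans (+-congˡ (trans (*-congʳ (x≈y⇒x∙y⁻¹≈ε s≈t)) (zeroˡ (χ s)))) (+-identityʳ _))

  -- At a root r one has φ t = (t - r) χ t, so every other root is a root of χ, which has the same
  -- leading coefficient and one degree less.
  #roots≤degree : ∀ d {φ a} → Polynomial d φ a → ¬ a ≈ 0# → 𝔽.# (λ t → φ t ≟ 0#) ℕ.≤ d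
  #roots≤degree zero    {φ} P a≉0 = ℕ.≤-reflexive (𝔽.#≡0 (λ t → φ t ≟ 0#) (λ t φt≈0 → a≉0 (trans (sym (P t)) φt≈0)))
  #roots≤degree (suc d) {φ} P a≉0
    with 𝔽.any? (λ s≈t φs≈0 → trans (sym (Polynomial⇒cong (suc d) P s≈t)) φs≈0) (λ t → φ t ≟ 0#)
  ... | no  no-root    = ℕ.≤-trans (ℕ.≤-reflexive (𝔽.#≡0 (λ t → φ t ≟ 0#) (λ t φt≈0 → no-root (t , φt≈0)))) z≤n
  ... | yes (r , φr≈0) = ≤-Reasoning.begin
      𝔽.# (λ t → φ t ≟ 0#)                                       ≤-Reasoning.≤⟨ 𝔽.∑-mono factor ⟩
      𝔽.∑ (λ t → [ t ≟ r ] ℕ.+ [ χ t ≟ 0# ])                     ≤-Reasoning.≡⟨ 𝔽.∑-+ (λ t → [ t ≟ r ]) (λ t → [ χ t ≟ 0# ]) ⟩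
      𝔽.# (_≟ r) ℕ.+ 𝔽.# (λ t → χ t ≟ 0#)
        ≤-Reasoning.≤⟨ ℕ.+-mono-≤ (𝔽.#≤1 (_≟ r) (λ s≈t s≈r → trans (sym s≈t) s≈r) (λ s≈r t≈r → trans s≈r (sym t≈r)))
                                 (#roots≤degree d (proj₁ (proj₂ (P r))) a≉0) ⟩
      suc d                                                       ≤-Reasoning.∎
    where
    module ≤-Reasoning = ℕ.≤-Reasoning
    χ = proj₁ (P r)
    factor : ∀ t → [ φ t ≟ 0# ] ℕ.≤ [ t ≟ r ] ℕ.+ [ χ t ≟ 0# ]
    factor t = by-cases (φ t ≟ 0#)
      where
      by-cases : (φt≈0? : Dec (φ t ≈ 0#)) → [ φt≈0? ] ℕ.≤ [ t ≟ r ] ℕ.+ [ χ t ≟ 0# ]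
      by-cases (no  _)    = z≤n
      by-cases (yes φt≈0) with no-zero-divisors (begin
        (t - r) * χ t        ≈⟨ +-identityˡ _ ⟨
        0# + (t - r) * χ t   ≈⟨ +-congʳ φr≈0 ⟨
        φ r + (t - r) * χ t  ≈⟨ proj₂ (proj₂ (P r)) t ⟨
        φ t                  ≈⟨ φt≈0 ⟩
        0#                   ∎)
      ... | inj₁ t-r≈0 = ℕ.≤-trans (ℕ.≤-reflexive (≡.sym ([]-yes (t ≟ r) (x∙y⁻¹≈ε⇒x≈y t r t-r≈0)))) (ℕ.m≤m+n _ _)
      ... | inj₂ χt≈0  = ℕ.≤-trans (ℕ.≤-reflexive (≡.sym ([]-yes (χ t ≟ 0#) χt≈0))) (ℕ.m≤n+m _ _)

  q≤degree+#nonroots : ∀ d {φ a} → Polynomial d φ a → ¬ a ≈ 0# → q ℕ.≤ d ℕ.+ 𝔽.# (λ t → nonzero? (φ t))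
  q≤degree+#nonroots d {φ} P a≉0 = ℕ.≤-trans (ℕ.≤-reflexive (≡.sym (𝔽.#-complement (λ t → φ t ≟ 0#))))
    (ℕ.+-monoˡ-≤ _ (#roots≤degree d P a≉0))

-- Forms of degree k and sums of forms

module Forms {c ℓ q} (F : FiniteField c ℓ q) (m : ℕ) where
  open FiniteField F hiding (zero)
  open FieldProperties F
  open Vectors F
  open Polynomials F
  open import Algebra.Solver.Ring.NaturalCoefficients.Default commutativeSemiring using (solve; _:=_; _:+_; _:*_)
  open import Relation.Binary.Reasoning.Setoid setoid

  private
    V = Vector Carrier m

  -- A form is recorded by its restrictions to lines: in the direction y the coefficient of t ^ k is
  -- `τ y`, independent of the base point x. Vectors are functions, so compatibility with pointwise
  -- equality is a field of its own.
  record Form (k : ℕ) (τ : V → Carrier) : Set (c ⊔ ℓ) where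
    field
      cong  : ∀ {x y} → x ≋ y → τ x ≈ τ y
      along : ∀ x y → Polynomial k (λ t → τ (x +ᵛ t *ᵛ y)) (τ y)

  open Form

  -- φ is a sum of forms of degrees at most k, of which τ is the one of degree k.
  data Graded : ℕ → (V → Carrier) → (V → Carrier) → Set (c ⊔ ℓ) where
    base : ∀ {φ τ} → Form 0 τ → (∀ x → φ x ≈ τ x) → Graded 0 φ τ
    step : ∀ {k φ τ ρ σ} → Form (suc k) τ → Graded k ρ σ → (∀ x → φ x ≈ τ x + ρ x) → Graded (suc k) φ τ

  Form-0 : ∀ k → Form k (λ _ → 0#)
  Form-0 k = record { cong = λ _ → refl ; along = λ _ _ → Polynomial-0 k }

  Form-cong : ∀ {k σ τ} → (∀ x → σ x ≈ τ x) → Form k σ → Form k τ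
  Form-cong {k} σ≈τ S = record
    { cong  = λ x≋y → trans (sym (σ≈τ _)) (trans (cong S x≋y) (σ≈τ _))
    ; along = λ x y → Polynomial-cong k (λ t → σ≈τ _) (σ≈τ y) (along S x y)
    }

  Form-+ : ∀ {k σ τ} → Form k σ → Form k τ → Form k (λ x → σ x + τ x)
  Form-+ {k} S T = record
    { cong  = λ x≋y → +-cong (cong S x≋y) (cong T x≋y)
    ; along = λ x y → Polynomial-+ k (along S x y) (along T x y)
    }

  Form-* : ∀ {k τ} s → Form k τ → Form k (λ x → s * τ x)
  Form-* {k} s T = record
    { cong  = λ x≋y → *-congˡ (cong T x≋y)
    ; along = λ x y → Polynomial-* k s (along T x y)
    }

  Form-*-linear : ∀ {k τ} h → Form k τ → Form (suc k) (λ x → τ x * (h · x))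
  Form-*-linear {k} h T = record
    { cong  = λ x≋y → *-cong (cong T x≋y) (·-congˡ h x≋y)
    ; along = λ x y → Polynomial-cong (suc k)
        (λ t → *-congˡ (sym (trans (·-+ h x (t *ᵛ y)) (+-congˡ (·-* h t y))))) refl
        (Polynomial-*-linear k (h · x) (h · y) (along T x y))
    }

  Graded-0 : ∀ k → Graded k (λ _ → 0#) (λ _ → 0#)
  Graded-0 zero    = base (Form-0 0) (λ _ → refl)
  Graded-0 (suc k) = step (Form-0 (suc k)) (Graded-0 k) (λ _ → sym (+-identityʳ 0#))

  Form⇒Graded : ∀ k {τ} → Form k τ → Graded k τ τ
  Form⇒Graded zero    T = base T (λ _ → refl)
  Form⇒Graded (suc k) T = step T (Graded-0 k) (λ _ → sym (+-identityʳ _))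

  Graded-cong : ∀ {k φ ψ σ τ} → (∀ x → φ x ≈ ψ x) → (∀ x → σ x ≈ τ x) → Graded k φ σ → Graded k ψ τ
  Graded-cong φ≈ψ σ≈τ (base S φ≈)   = base (Form-cong σ≈τ S) (λ x → trans (sym (φ≈ψ x)) (trans (φ≈ x) (σ≈τ x)))
  Graded-cong φ≈ψ σ≈τ (step S G φ≈) = step (Form-cong σ≈τ S) G (λ x → trans (sym (φ≈ψ x)) (trans (φ≈ x) (+-congʳ (σ≈τ x))))

  Graded-+ : ∀ {k φ ψ σ τ} → Graded k φ σ → Graded k ψ τ → Graded k (λ x → φ x + ψ x) (λ x → σ x + τ x)
  Graded-+ (base S φ≈)   (base T ψ≈)   = base (Form-+ S T) (λ x → +-cong (φ≈ x) (ψ≈ x))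
  Graded-+ (step S G φ≈) (step T H ψ≈) = step (Form-+ S T) (Graded-+ G H)
    (λ x → trans (+-cong (φ≈ x) (ψ≈ x))
      (solve 4 (λ a b c d → (a :+ b) :+ (c :+ d) := (a :+ c) :+ (b :+ d)) refl _ _ _ _))

  Graded-* : ∀ {k φ τ} s → Graded k φ τ → Graded k (λ x → s * φ x) (λ x → s * τ x)
  Graded-* s (base T φ≈)   = base (Form-* s T) (λ x → *-congˡ (φ≈ x))
  Graded-* s (step T G φ≈) = step (Form-* s T) (Graded-* s G) (λ x → trans (*-congˡ (φ≈ x)) (distribˡ s _ _))

  Graded-*-affine : ∀ {k φ τ} b h → Graded k φ τ →
                    Graded (suc k) (λ x → φ x * (b + h · x)) (λ x → τ x * (h · x))
  Graded-*-affine b h (base {φ} {τ} T φ≈) = step (Form-*-linear h T) (base (Form-* b T) (λ _ → refl))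
    (λ x → trans (*-congʳ (φ≈ x)) (solve 3 (λ t b l → t :* (b :+ l) := t :* l :+ b :* t) refl (τ x) b (h · x)))
  Graded-*-affine b h (step {k} {φ} {τ} {ρ} T G φ≈) = step (Form-*-linear h T)
    (Graded-+ (Form⇒Graded (suc k) (Form-* b T)) (Graded-*-affine b h G))
    (λ x → trans (*-congʳ (φ≈ x)) (solve 4 (λ t r b l → (t :+ r) :* (b :+ l) := t :* l :+ (b :* t :+ r :* (b :+ l)))
      refl (τ x) (ρ x) b (h · x)))

  -- The shift `b` enters the lower forms only. With `h · v` for `b` this shows that translating the
  -- argument leaves the top form unchanged.
  Graded-power : ∀ k b h → Graded k (λ x → (b + h · x) ^ k) (λ x → (h · x) ^ k)
  Graded-power zero    b h = base (record { cong = λ _ → refl ; along = λ _ _ _ → refl }) (λ _ → refl)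
  Graded-power (suc k) b h = Graded-cong (λ _ → *-comm _ _) (λ _ → *-comm _ _) (Graded-*-affine b h (Graded-power k b h))

  Graded-∑ : ∀ k {l} {φ τ : Fin l → V → Carrier} → (∀ i → Graded k (φ i) (τ i)) →
             Graded k (λ x → sum (λ i → φ i x)) (λ x → sum (λ i → τ i x))
  Graded-∑ k {zero}  G = Graded-0 k
  Graded-∑ k {suc l} G = Graded-+ (G zero) (Graded-∑ k (G ∘ suc))

  Graded-along : ∀ {k φ τ} → Graded k φ τ → ∀ x y → Polynomial k (λ t → φ (x +ᵛ t *ᵛ y)) (τ y)
  Graded-along         (base T φ≈)   x y = Polynomial-cong 0 (λ t → sym (φ≈ _)) refl (along T x y)
  Graded-along {suc k} (step T G φ≈) x y = Polynomial-cong (suc k) (λ t → sym (φ≈ _)) (+-identityʳ _)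
    (Polynomial-+ (suc k) (along T x y) (Polynomial-raise k (Graded-along G x y)))

-- Subspaces and the support of a power sum

module Subspaces {c ℓ q} (F : FiniteField c ℓ q) (m : ℕ) where
  open FiniteField F hiding (zero)
  open FieldProperties F
  open Vectors F
  open Polynomials F
  open Forms F m
  open import Algebra.Solver.Ring.NaturalCoefficients.Default commutativeSemiring using (solve; _:=_; _:+_; _:*_)

  private
    V = Vector Carrier m

  record Subspace : Set (Level.suc (c ⊔ ℓ)) where
    field
      Member   : Pred V (c ⊔ ℓ)
      member?  : Decidable Member
      resp     : Member Respects _≋_
      0-closed : 0ᵛ ∈ Member
      +-closed : ∀ {x y} → x ∈ Member → y ∈ Member → x +ᵛ y ∈ Member
      *-closed : ∀ s {x} → x ∈ Member → s *ᵛ x ∈ Member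

  open Subspace

  trivial : Subspace
  trivial = record
    { Member   = λ x → Lift c (x ≋ 0ᵛ)
    ; member?  = λ x → map′ lift lower (x ≋? 0ᵛ)
    ; resp     = λ x≋y (lift x≋0) → lift (λ i → trans (sym (x≋y i)) (x≋0 i))
    ; 0-closed = lift (λ i → refl)
    ; +-closed = λ (lift x≋0) (lift y≋0) → lift (λ i → trans (+-cong (x≋0 i) (y≋0 i)) (+-identityʳ 0#))
    ; *-closed = λ s (lift x≋0) → lift (λ i → trans (*-congˡ (x≋0 i)) (zeroʳ s))
    }

  infixl 6 _⊕⟨_⟩

  -- Membership asks whether x + t v lies in S for some t, so that deciding it is a search over
  -- scalars and not over the elements of S.
  _⊕⟨_⟩ : Subspace → V → Subspace
  S ⊕⟨ v ⟩ = record
    { Member   = λ x → ∃[ t ] x +ᵛ t *ᵛ v ∈ Member S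
    ; member?  = λ x → 𝔽.any? (λ s≈t → resp S (λ i → +-congˡ (*-congʳ s≈t))) (λ t → member? S (x +ᵛ t *ᵛ v))
    ; resp     = λ x≋y (t , x∈) → t , resp S (λ i → +-congʳ (x≋y i)) x∈
    ; 0-closed = 0# , resp S (λ i → sym (trans (+-identityˡ _) (zeroˡ (v i)))) (0-closed S)
    ; +-closed = λ {x} {y} (s , x∈) (t , y∈) → s + t , resp S
        (λ i → solve 5 (λ x y s t v → (x :+ s :* v) :+ (y :+ t :* v) := (x :+ y) :+ (s :+ t) :* v) refl (x i) (y i) s t (v i))
        (+-closed S x∈ y∈)
    ; *-closed = λ s {x} (t , x∈) → s * t , resp S
        (λ i → solve 4 (λ x s t v → s :* (x :+ t :* v) := s :* x :+ (s :* t) :* v) refl (x i) s t (v i))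
        (*-closed S s x∈)
    }

  ⊆-⊕ : ∀ S v → Member S ⊆ Member (S ⊕⟨ v ⟩)
  ⊆-⊕ S v {x} x∈S = 0# , resp S (λ i → sym (trans (+-congˡ (zeroˡ (v i))) (+-identityʳ (x i)))) x∈S

  ∈-⊕ : ∀ S v → v ∈ Member (S ⊕⟨ v ⟩)
  ∈-⊕ S v = - 1# , resp S (λ i → sym (trans (+-congˡ (-1*x≈-x (v i))) (-‿inverseʳ (v i)))) (0-closed S)

  -- Maximal subspaces on which a homogeneous function vanishes

  module _ {f : V → Carrier} (f-cong : ∀ {x y} → x ≋ y → f x ≈ f y) (f-0 : f 0ᵛ ≈ 0#)
           (f-* : ∀ {s} → ¬ s ≈ 0# → ∀ x → f (s *ᵛ x) ≈ f x) where

    Vanishing : Subspace → Set _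
    Vanishing S = ∀ x → x ∈ Member S → f x ≈ 0#

    -- The premise makes this hold trivially once v has been absorbed into S, and so the property
    -- survives enlarging S.
    NonvanishingAt : Subspace → V → Set _
    NonvanishingAt S v = v ∉ Member S → ∃[ x ] x ∈ Member S × ¬ f (v +ᵛ x) ≈ 0#

    -- If f is nonzero at x, where x + t v is in S, then t is nonzero, as f vanishes on S. Scaling
    -- by r = -1/t takes x to v + r (x + t v), which lies in v + S, and does not change the value of
    -- f.
    extend : ∀ S → Vanishing S → ∀ v →
             NonvanishingAt S v ⊎ Vanishing (S ⊕⟨ v ⟩)
    extend S S-vanishing v
      with 𝕍.any? (λ x≋y (x∈ , fx≉0) → resp (S ⊕⟨ v ⟩) x≋y x∈ , λ fy≈0 → fx≉0 (trans (f-cong x≋y) fy≈0))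
             (λ x → member? (S ⊕⟨ v ⟩) x ×-dec nonzero? (f x))
    ... | no  none = inj₂ λ x x∈ → decidable-stable (f x ≟ 0#) (λ fx≉0 → none (x , x∈ , fx≉0))
    ... | yes (x , (t , x+tv∈S) , fx≉0) = inj₁ λ _ →
      r *ᵛ (x +ᵛ t *ᵛ v) , *-closed S r x+tv∈S , λ f≈0 → fx≉0 (trans (sym (f-* r≉0 x)) (trans (f-cong rx≋) f≈0))
      where
      t≉0 : ¬ t ≈ 0#
      t≉0 t≈0 = fx≉0 (S-vanishing x
        (resp S (λ i → trans (+-congˡ (trans (*-congʳ t≈0) (zeroˡ (v i)))) (+-identityʳ (x i))) x+tv∈S))
      t⁻¹    = proj₁ (inverse t t≉0)
      t⁻¹t≈1 = proj₁ (proj₂ (inverse t t≉0))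
      r = - t⁻¹
      r≉0 : ¬ r ≈ 0#
      r≉0 r≈0 = proj₂ (proj₂ (inverse t t≉0)) (-‿injective (trans r≈0 (sym -0#≈0#)))
      rx≋ : r *ᵛ x ≋ v +ᵛ r *ᵛ (x +ᵛ t *ᵛ v)
      rx≋ i = begin
        r * x i                              ≈⟨ +-identityʳ _ ⟨
        r * x i + 0#                         ≈⟨ +-congˡ (-‿inverseʳ (v i)) ⟨
        r * x i + (v i - v i)                ≈⟨ +-congˡ (+-congˡ (-1*x≈-x (v i))) ⟨
        r * x i + (v i + - 1# * v i)         ≈⟨ +-congˡ (+-congˡ (*-congʳ (trans (sym (-‿distribˡ-* t⁻¹ t)) (-‿cong t⁻¹t≈1)))) ⟨
        r * x i + (v i + r * t * v i)        ≈⟨ solve 4 (λ x r t v → r :* x :+ (v :+ r :* t :* v) := v :+ r :* (x :+ t :* v)) refl (x i) r t (v i) ⟩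
        v i + r * (x i + t * v i)            ∎
        where open import Relation.Binary.Reasoning.Setoid setoid

    -- Each vector is tried once: a failed attempt to adjoin it leaves a witness in its coset, and
    -- this witness remains valid when S grows later.
    greedy : (vs : List V) → ∃[ S ] Vanishing S × All (NonvanishingAt S) vs
    greedy [] = trivial , (λ x (lift x≋0) → trans (f-cong x≋0) f-0) , []
    greedy (v ∷ vs) with greedy vs
    ... | S , S-vanishing , vs-nonvanishing with extend S S-vanishing v
    ...   | inj₁ v-nonvanishing = S , S-vanishing , v-nonvanishing ∷ vs-nonvanishing
    ...   | inj₂ S⊕v-vanishing  = S ⊕⟨ v ⟩ , S⊕v-vanishing ,
      (λ v∉S⊕v → contradiction (∈-⊕ S v) v∉S⊕v) ∷
      All.map (λ {w} → inherit w) vs-nonvanishing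
      where
      inherit : ∀ w → NonvanishingAt S w → NonvanishingAt (S ⊕⟨ v ⟩) w
      inherit w nonvanishing w∉S⊕v =
        let x , x∈S , f≉0 = nonvanishing (λ w∈S → w∉S⊕v (⊆-⊕ S v w∈S)) in x , ⊆-⊕ S v x∈S , f≉0

    maximal-vanishing : ∃[ S ] Vanishing S × (∀ v → NonvanishingAt S v)
    maximal-vanishing with greedy (List.tabulate 𝕍.element)
    ... | S , S-vanishing , nonvanishing = S , S-vanishing , λ v v∉S →
      let x , x∈S , f≉0 = All.tabulate⁻ nonvanishing (𝕍.index v) (v∉S ∘ resp S (𝕍.element-index v))
      in x , x∈S , λ f≈0 → f≉0 (trans (f-cong (λ i → +-congʳ (𝕍.element-index v i))) f≈0)

  -- If the top form is zero as a function on S, it is dropped, which does not change φ on S;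
  -- otherwise any y in S where it is nonzero will do. At degree 0 the form is constant, and `x`
  -- itself serves as direction.
  leading-form : ∀ {k φ τ} → Graded k φ τ → ∀ S x → x ∈ Member S → ¬ φ x ≈ 0# →
    ∃[ d ] d ℕ.≤ k × ∃[ y ] y ∈ Member S × ∃[ a ] ¬ a ≈ 0# ×
    (∀ x → x ∈ Member S → Polynomial d (λ t → φ (x +ᵛ t *ᵛ y)) a)
  leading-form G@(base {τ = τ} T φ≈) S x x∈S φx≉0 =
    0 , z≤n , x , x∈S , τ x , (λ τx≈0 → φx≉0 (trans (φ≈ x) τx≈0)) , λ z _ → Graded-along G z x
  leading-form G@(step {k} {φ} {τ} {ρ} T H φ≈) S x x∈S φx≉0
    with 𝕍.any? (λ x≋y (x∈ , τx≉0) → resp S x≋y x∈ , λ τy≈0 → τx≉0 (trans (Form.cong T x≋y) τy≈0))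
           (λ y → member? S y ×-dec nonzero? (τ y))
  ... | yes (y , y∈S , τy≉0) = suc k , ℕ.≤-refl , y , y∈S , τ y , τy≉0 , λ z _ → Graded-along G z y
  ... | no  none =
    let d , d≤k , y , y∈S , a , a≉0 , P = leading-form H S x x∈S (λ ρx≈0 → φx≉0 (trans (φ≈ρ x x∈S) ρx≈0))
    in d , ℕ.m≤n⇒m≤1+n d≤k , y , y∈S , a , a≉0 , λ z z∈S →
       Polynomial-cong d (λ t → sym (φ≈ρ _ (+-closed S z∈S (*-closed S t y∈S)))) refl (P z z∈S)
    where
    φ≈ρ : ∀ z → z ∈ Member S → φ z ≈ ρ z
    φ≈ρ z z∈S = trans (φ≈ z) (trans
      (+-congʳ (decidable-stable (τ z ≟ 0#) (λ τz≉0 → none (z , z∈S , τz≉0))))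
      (+-identityˡ (ρ z)))

  module _ (S : Subspace) where

    #S>0 : 0 ℕ.< 𝕍.# (member? S)
    #S>0 = ℕ.≤-trans
      (ℕ.≤-reflexive (≡.sym (𝕍.#≡1 {m} (_≋? 0ᵛ) (λ x≋y x≋0 i → trans (sym (x≋y i)) (x≋0 i))
        (λ x≋0 y≋0 i → trans (x≋0 i) (sym (y≋0 i))) 0ᵛ (λ i → refl))))
      (𝕍.∑-mono (λ x → []-mono (x ≋? 0ᵛ) (member? S x) (λ x≋0 → resp S (λ i → sym (x≋0 i)) (0-closed S))))

    cancelʳ : ∀ {x y} → y ∈ Member S → x +ᵛ y ∈ Member S → x ∈ Member S
    cancelʳ {x} {y} y∈S x+y∈S = resp S
      (λ i → trans (+-congˡ (-1*x≈-x (y i))) (//-rightDividesʳ (y i) (x i)))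
      (+-closed S x+y∈S (*-closed S (- 1#) y∈S))

    #S-invariant : ∀ {y} → y ∈ Member S → ∀ x → [ member? S (x +ᵛ y) ] ≡ [ member? S x ]
    #S-invariant {y} y∈S x = []-cong (member? S (x +ᵛ y)) (member? S x) (cancelʳ y∈S) (λ x∈S → +-closed S x∈S y∈S)

    -- The translates of S along v are disjoint: if x + s v and x + t v are both in S with s and t
    -- distinct, then (s - t) v is in S, and hence v.
    q*#proper≤ : ∀ v → v ∉ Member S → q ℕ.* 𝕍.# (member? S) ℕ.≤ q ℕ.^ m
    q*#proper≤ v v∉S = begin
      q ℕ.* 𝕍.# (member? S)                              ≡⟨ 𝔽.∑-const _ ⟨
      𝔽.∑ (λ t → 𝕍.# (member? S))                        ≡⟨ 𝔽.∑-cong (λ t → translate (t *ᵛ v) (λ x → [ member? S x ]) S-cong) ⟩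
      𝔽.∑ (λ t → 𝕍.∑ (λ x → [ member? S (x +ᵛ t *ᵛ v) ]))  ≡⟨ ∑-swap finite (vector-finite m) (λ t x → [ member? S (x +ᵛ t *ᵛ v) ]) ⟩
      𝕍.∑ (λ x → 𝔽.# (λ t → member? S (x +ᵛ t *ᵛ v)))    ≤⟨ 𝕍.∑-mono at-most-one ⟩
      𝕍.∑ {m} (λ x → 1)                                  ≡⟨ 𝕍.∑-const {m} 1 ⟩
      q ℕ.^ m ℕ.* 1                                      ≡⟨ ℕ.*-identityʳ _ ⟩
      q ℕ.^ m                                            ∎
      where
      open ℕ.≤-Reasoning
      S-cong : ∀ {x y} → x ≋ y → [ member? S x ] ≡ [ member? S y ]
      S-cong x≋y = []-cong (member? S _) (member? S _) (resp S x≋y) (resp S (λ i → sym (x≋y i)))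
      at-most-one : ∀ x → 𝔽.# (λ t → member? S (x +ᵛ t *ᵛ v)) ℕ.≤ 1
      at-most-one x = 𝔽.#≤1 (λ t → member? S (x +ᵛ t *ᵛ v)) (λ s≈t → resp S (λ i → +-congˡ (*-congʳ s≈t))) unique
        where
        unique : ∀ {s t} → x +ᵛ s *ᵛ v ∈ Member S → x +ᵛ t *ᵛ v ∈ Member S → s ≈ t
        unique {s} {t} x+sv∈S x+tv∈S = decidable-stable (s ≟ t) (λ s≉t →
          let r , r[s-t]≈1 , _ = inverse (s - t) (λ s-t≈0 → s≉t (x∙y⁻¹≈ε⇒x≈y s t s-t≈0)) in
          v∉S (resp S (λ i → trans (sym (*-assoc r (s - t) (v i))) (trans (*-congʳ r[s-t]≈1) (*-identityˡ (v i))))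
            (*-closed S r (cancelʳ x+tv∈S (resp S (λ i → sym (split i)) x+sv∈S)))))
          where
          split : ∀ i → (s - t) * v i + (x i + t * v i) ≈ x i + s * v i
          split i = trans
            (solve 4 (λ d v x t → d :* v :+ (x :+ t :* v) := x :+ (d :+ t) :* v) refl (s - t) (v i) (x i) t)
            (+-congˡ (*-congʳ (//-rightDividesˡ t s)))

  -- Averaging over the pairs of a point of v + S and a line through it in the direction y.
  module _ (S : Subspace) {f : V → Carrier} (f-cong : ∀ {x y} → x ≋ y → f x ≈ f y) where

    private
      support? : ∀ v x → Dec (¬ f (v +ᵛ x) ≈ 0#)
      support? v x = nonzero? (f (v +ᵛ x))

    coset-bound : ∀ k v y → y ∈ Member S →
      (∀ x → x ∈ Member S → k ℕ.≤ 𝔽.# (λ t → support? v (x +ᵛ t *ᵛ y))) →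
      k ℕ.* 𝕍.# (member? S) ℕ.≤ q ℕ.* 𝕍.∑ (λ x → [ member? S x ] ℕ.* [ support? v x ])
    coset-bound k v y y∈S line-bound = begin
      k ℕ.* 𝕍.# (member? S)                                             ≡⟨ ℕ.*-comm k _ ⟩
      𝕍.# (member? S) ℕ.* k                                             ≡⟨ 𝕍.∑-*ʳ k (λ x → [ member? S x ]) ⟨
      𝕍.∑ (λ x → [ member? S x ] ℕ.* k)                                 ≤⟨ 𝕍.∑-mono (λ x → on-member (member? S x) (line-bound x)) ⟩
      𝕍.∑ (λ x → [ member? S x ] ℕ.* 𝔽.# (λ t → support? v (x +ᵛ t *ᵛ y)))
        ≡⟨ 𝕍.∑-cong (λ x → 𝔽.∑-*ˡ [ member? S x ] (λ t → [ support? v (x +ᵛ t *ᵛ y) ])) ⟨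
      𝕍.∑ (λ x → 𝔽.∑ (λ t → [ member? S x ] ℕ.* [ support? v (x +ᵛ t *ᵛ y) ]))
        ≡⟨ ∑-swap (vector-finite m) finite (λ x t → [ member? S x ] ℕ.* [ support? v (x +ᵛ t *ᵛ y) ]) ⟩
      𝔽.∑ (λ t → 𝕍.∑ (λ x → [ member? S x ] ℕ.* [ support? v (x +ᵛ t *ᵛ y) ]))
        ≡⟨ 𝔽.∑-cong (λ t → 𝕍.∑-cong (λ x → ≡.cong (ℕ._* [ support? v (x +ᵛ t *ᵛ y) ]) (#S-invariant S (*-closed S t y∈S) x))) ⟨
      -- Translation by t y maps S onto itself, so each of the q values of t contributes the same
      -- number.
      𝔽.∑ (λ t → 𝕍.∑ (λ x → φ (x +ᵛ t *ᵛ y)))                           ≡⟨ 𝔽.∑-cong (λ t → translate (t *ᵛ y) φ φ-cong) ⟨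
      𝔽.∑ (λ t → 𝕍.∑ φ)                                                 ≡⟨ 𝔽.∑-const _ ⟩
      q ℕ.* 𝕍.∑ φ                                                       ∎
      where
      open ℕ.≤-Reasoning
      φ : V → ℕ
      φ x = [ member? S x ] ℕ.* [ support? v x ]
      φ-cong : ∀ {x y} → x ≋ y → φ x ≡ φ y
      φ-cong {x} {y} x≋y = ≡.cong₂ ℕ._*_
        ([]-cong (member? S x) (member? S y) (resp S x≋y) (resp S (λ i → sym (x≋y i))))
        ([]-cong (support? v x) (support? v y) (λ fx≉0 fy≈0 → fx≉0 (trans fx≈fy fy≈0)) (λ fy≉0 fx≈0 → fy≉0 (trans (sym fx≈fy) fx≈0)))
        where
        fx≈fy : f (v +ᵛ x) ≈ f (v +ᵛ y)
        fx≈fy = f-cong (λ i → +-congˡ (x≋y i))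
      on-member : ∀ {a} {A : Set a} {l} (A? : Dec A) → (A → k ℕ.≤ l) → [ A? ] ℕ.* k ℕ.≤ [ A? ] ℕ.* l
      on-member (yes a) k≤l = ℕ.*-monoʳ-≤ 1 (k≤l a)
      on-member (no _)  _   = z≤n

    -- The coset bounds are summed over v outside S, and the right-hand sum is then extended to all
    -- v. There each support vector w is met once for every x in S, as w = v + x, so the size of S
    -- cancels.
    complement-bound : ∀ k →
      (∀ v → v ∉ Member S → k ℕ.* 𝕍.# (member? S) ℕ.≤ q ℕ.* 𝕍.∑ (λ x → [ member? S x ] ℕ.* [ support? v x ])) →
      𝕍.# (λ v → ¬? (member? S v)) ℕ.* k ℕ.≤ q ℕ.* 𝕍.# (λ x → nonzero? (f x))
    complement-bound k bound = ℕ.*-cancelʳ-≤ _ _ #S {{ℕ.>-nonZero (#S>0 S)}} (begin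
      𝕍.# outside? ℕ.* k ℕ.* #S                                 ≡⟨ ℕ.*-assoc (𝕍.# outside?) k #S ⟩
      𝕍.# outside? ℕ.* (k ℕ.* #S)                               ≡⟨ 𝕍.∑-*ʳ (k ℕ.* #S) (λ v → [ outside? v ]) ⟨
      𝕍.∑ (λ v → [ outside? v ] ℕ.* (k ℕ.* #S))                 ≤⟨ 𝕍.∑-mono (λ v → drop (outside? v) (bound v)) ⟩
      𝕍.∑ (λ v → q ℕ.* 𝕍.∑ (λ x → [ member? S x ] ℕ.* [ support? v x ]))
        ≡⟨ 𝕍.∑-*ˡ q (λ v → 𝕍.∑ (λ x → [ member? S x ] ℕ.* [ support? v x ])) ⟩
      q ℕ.* 𝕍.∑ (λ v → 𝕍.∑ (λ x → [ member? S x ] ℕ.* [ support? v x ]))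
        ≡⟨ ≡.cong (q ℕ.*_) (∑-swap (vector-finite m) (vector-finite m) (λ v x → [ member? S x ] ℕ.* [ support? v x ])) ⟩
      q ℕ.* 𝕍.∑ (λ x → 𝕍.∑ (λ v → [ member? S x ] ℕ.* [ support? v x ]))
        ≡⟨ ≡.cong (q ℕ.*_) (𝕍.∑-cong (λ x → ≡.trans
             (𝕍.∑-*ˡ [ member? S x ] (λ v → [ support? v x ]))
             (≡.cong ([ member? S x ] ℕ.*_) (≡.sym (translate x (λ v → [ nonzero? (f v) ]) f≉0-cong))))) ⟩
      q ℕ.* 𝕍.∑ (λ x → [ member? S x ] ℕ.* N)                   ≡⟨ ≡.cong (q ℕ.*_) (𝕍.∑-*ʳ N (λ x → [ member? S x ])) ⟩
      q ℕ.* (#S ℕ.* N)                                          ≡⟨ ≡.cong (q ℕ.*_) (ℕ.*-comm #S N) ⟩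
      q ℕ.* (N ℕ.* #S)                                          ≡⟨ ℕ.*-assoc q N #S ⟨
      q ℕ.* N ℕ.* #S                                            ∎)
      where
      open ℕ.≤-Reasoning
      #S = 𝕍.# (member? S)
      N  = 𝕍.# (λ x → nonzero? (f x))
      outside? = λ v → ¬? (member? S v)
      drop : ∀ {a} {A : Set a} {l m} (A? : Dec A) → (A → l ℕ.≤ m) → [ A? ] ℕ.* l ℕ.≤ m
      drop {l = l} (yes a) l≤m = ℕ.≤-trans (ℕ.≤-reflexive (ℕ.*-identityˡ l)) (l≤m a)
      drop (no _)          _   = z≤n
      f≉0-cong : ∀ {x y} → x ≋ y → [ nonzero? (f x) ] ≡ [ nonzero? (f y) ]
      f≉0-cong {x} {y} x≋y = []-cong (nonzero? (f x)) (nonzero? (f y))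
        (λ fx≉0 fy≈0 → fx≉0 (trans (f-cong x≋y) fy≈0)) (λ fy≉0 fx≈0 → fy≉0 (trans (sym (f-cong x≋y)) fx≈0))

-- Power sums of linear forms and the size of their support

module PowerSums {c ℓ q} (F : FiniteField c ℓ q) {m l : ℕ} where
  open FiniteField F hiding (zero)
  open FieldProperties F
  open Vectors F
  open Polynomials F
  open Forms F m
  open Subspaces F m
  open Subspace

  module _ (a : Fin l → Carrier) (h : Fin l → Vector Carrier m) where

    powerSum : Vector Carrier m → Carrier
    powerSum x = sum (λ i → a i * (h i · x) ^ (q ∸ 1))

    powerSum-cong : ∀ {x y} → x ≋ y → powerSum x ≈ powerSum y
    powerSum-cong x≋y = sum-cong-≋ {l} (λ i → *-congˡ (^-congˡ (q ∸ 1) (·-congˡ (h i) x≋y)))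

    powerSum-* : ∀ {s} → ¬ s ≈ 0# → ∀ x → powerSum (s *ᵛ x) ≈ powerSum x
    powerSum-* {s} s≉0 x = sum-cong-≋ {l} (λ i → *-congˡ (begin
      (h i · (s *ᵛ x)) ^ (q ∸ 1)            ≈⟨ ^-congˡ (q ∸ 1) (·-* (h i) s x) ⟩
      (s * (h i · x)) ^ (q ∸ 1)             ≈⟨ ^-distrib-* s (h i · x) (q ∸ 1) ⟩
      s ^ (q ∸ 1) * (h i · x) ^ (q ∸ 1)     ≈⟨ *-congʳ (fermat s≉0) ⟩
      1# * (h i · x) ^ (q ∸ 1)              ≈⟨ *-identityˡ _ ⟩
      (h i · x) ^ (q ∸ 1)                   ∎))
      where open import Relation.Binary.Reasoning.Setoid setoid

    powerSum-graded : ∀ v → Graded (q ∸ 1) (λ x → powerSum (v +ᵛ x)) powerSum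
    powerSum-graded v = Graded-cong
      (λ x → sum-cong-≋ {l} (λ i → *-congˡ (^-congˡ (q ∸ 1) (sym (·-+ (h i) v x))))) (λ x → refl)
      (Graded-∑ (q ∸ 1) (λ i → Graded-* (a i) (Graded-power (q ∸ 1) (h i · v) (h i))))

    powerSum-0 : powerSum 0ᵛ ≈ 0#
    powerSum-0 = trans
      (sum-cong-≋ {l} (λ i → trans (*-congˡ (^[q-1]≈0 (·-0 (h i)))) (zeroʳ (a i))))
      (sum-replicate-zero l)

    -- The top form of the translate is `powerSum`, which vanishes on S, so on S the translate
    -- equals its lower part `ρ` of degree at most k = q - 2. A leading degree d of that part leaves
    -- at least q - d non-roots on a line.
    two-on-lines : ∀ {k} S → q ≡ 2 ℕ.+ k → (∀ x → x ∈ Member S → powerSum x ≈ 0#) →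
      ∀ v x → x ∈ Member S → ¬ powerSum (v +ᵛ x) ≈ 0# →
      ∃[ y ] y ∈ Member S × (∀ x → x ∈ Member S → 2 ℕ.≤ 𝔽.# (λ t → nonzero? (powerSum (v +ᵛ (x +ᵛ t *ᵛ y)))))
    -- Rewriting q as 2 + k turns the degree q - 1 into `suc k`, so that only `step` can occur.
    two-on-lines {k} S q≡ vanishing v x x∈S f≉0 = split (≡.subst (λ d → Graded (d ∸ 1) (λ x → powerSum (v +ᵛ x)) powerSum) q≡ (powerSum-graded v))
      where
      split : Graded (suc k) (λ x → powerSum (v +ᵛ x)) powerSum → _
      split (step {ρ = ρ} _ G f≈) =
        let d , d≤k , y , y∈S , a , a≉0 , P = leading-form G S x x∈S (λ ρx≈0 → f≉0 (trans (f≈ρ x x∈S) ρx≈0))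
        in y , y∈S , λ z z∈S → ℕ.+-cancelʳ-≤ k _ _ (ℕ.≤-trans
             (ℕ.≤-trans (ℕ.≤-reflexive (≡.sym q≡))
               (q≤degree+#nonroots d (Polynomial-cong d (λ t → sym (f≈ρ _ (+-closed S z∈S (*-closed S t y∈S)))) refl (P z z∈S)) a≉0))
             (ℕ.≤-trans (ℕ.+-monoˡ-≤ _ d≤k) (ℕ.≤-reflexive (ℕ.+-comm k _))))
        where
        f≈ρ : ∀ z → z ∈ Member S → powerSum (v +ᵛ z) ≈ ρ z
        f≈ρ z z∈S = trans (f≈ z) (trans (+-congʳ (vanishing z z∈S)) (+-identityˡ (ρ z)))

    -- This is the bound (2 / q) (q^m - q^(m - 1)) for the support, multiplied by q^2 and with the
    -- negative term moved to the right. That term comes from the size of the proper subspace S.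
    powerSum-support : ∀ {k} → q ≡ 2 ℕ.+ k → ∀ v → ¬ powerSum v ≈ 0# →
      2 ℕ.* (q ℕ.* q ℕ.^ m) ℕ.≤ q ℕ.* (q ℕ.* 𝕍.# (λ x → nonzero? (powerSum x))) ℕ.+ 2 ℕ.* q ℕ.^ m
    powerSum-support q≡ v fv≉0 = begin
      2 ℕ.* (q ℕ.* q ℕ.^ m)                              ≡⟨ ≡.cong (λ k → 2 ℕ.* (q ℕ.* k)) (𝕍.#-complement (member? S)) ⟨
      2 ℕ.* (q ℕ.* (#S ℕ.+ #outside))                    ≡⟨ ℕSolver.solve 3 (λ q s t → ℕSolver.con 2 ℕSolver.:* (q ℕSolver.:* (s ℕSolver.:+ t)) ℕSolver.:=
                                                              q ℕSolver.:* (t ℕSolver.:* ℕSolver.con 2) ℕSolver.:+ ℕSolver.con 2 ℕSolver.:* (q ℕSolver.:* s)) ≡.refl q #S #outside ⟩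
      q ℕ.* (#outside ℕ.* 2) ℕ.+ 2 ℕ.* (q ℕ.* #S)        ≤⟨ ℕ.+-mono-≤ (ℕ.*-monoʳ-≤ q (complement-bound S powerSum-cong 2 coset))
                                                              (ℕ.*-monoʳ-≤ 2 (q*#proper≤ S v (λ v∈S → fv≉0 (vanishing v v∈S)))) ⟩
      q ℕ.* (q ℕ.* N) ℕ.+ 2 ℕ.* q ℕ.^ m                  ∎
      where
      open ℕ.≤-Reasoning
      module ℕSolver = Data.Nat.Solver.+-*-Solver
      maximal : ∃[ S ] (∀ x → x ∈ Member S → powerSum x ≈ 0#) × _
      maximal = maximal-vanishing powerSum-cong powerSum-0 powerSum-*
      S            = proj₁ maximal
      vanishing    = proj₁ (proj₂ maximal)
      nonvanishing = proj₂ (proj₂ maximal)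
      #S           = 𝕍.# (member? S)
      #outside     = 𝕍.# (λ v → ¬? (member? S v))
      N            = 𝕍.# (λ x → nonzero? (powerSum x))
      coset : ∀ v → v ∉ Member S → _
      coset v v∉S =
        let x , x∈S , f≉0  = nonvanishing v v∉S
            y , y∈S , lines = two-on-lines S q≡ vanishing v x x∈S f≉0
        in coset-bound S powerSum-cong 2 v y y∈S lines

-- Intersections of hyperplanes

module HyperplaneCounts {c ℓ q} (F : FiniteField c ℓ q) (k : ℕ) where
  private
    n : ℕ
    n = suc (suc k)

  open FiniteField F hiding (zero)
  open FieldProperties F
  open Vectors F
  open Points F n
  open ProjectiveSpace F n

  q-1 : ℕ
  q-1 = 𝔽.# nonzero?

  kernel-resp : ∀ h {x y : Coordinates} → x ∼ y → h · x ≈ 0# → h · y ≈ 0#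
  kernel-resp h {x} {y} x∼y hx≈0 = let s , _ , y≈sx = ∼-sym x∼y in
    trans (·-congˡ h y≈sx) (trans (·-* h s x) (trans (*-congˡ hx≈0) (zeroʳ s)))

  ≉0-resp : ∀ {x y : Coordinates} → x ∼ y → ¬ (x ≋ 0ᵛ) → ¬ (y ≋ 0ᵛ)
  ≉0-resp (s , _ , x≈sy) x≉0 y≋0 = x≉0 (λ i → trans (x≈sy i) (trans (*-congˡ (y≋0 i)) (zeroʳ s)))

  #vectors≡1+[q-1]#points :
    ∀ {r} {Q : Pred Coordinates r} (Q? : Decidable Q) → Q Respects _∼_ → Q 0ᵛ →
    𝕍.# Q? ≡ suc (q-1 ℕ.* ℙ.# (λ P → Q? (homogeneous P)))
  #vectors≡1+[q-1]#points {Q = Q} Q? Q-resp Q0 = begin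
    𝕍.# Q?                                                ≡⟨ 𝕍.∑-cong {suc n} split ⟩
    𝕍.∑ {suc n} (λ x → [ x ≋? 0ᵛ ] ℕ.+ [ nonzero-Q? x ])          ≡⟨ 𝕍.∑-+ {suc n} (λ x → [ x ≋? 0ᵛ ]) (λ x → [ nonzero-Q? x ]) ⟩
    𝕍.# {suc n} (_≋? 0ᵛ) ℕ.+ 𝕍.# nonzero-Q?                       ≡⟨ ≡.cong₂ ℕ._+_
      (𝕍.#≡1 {suc n} (_≋? 0ᵛ) (λ x≋y x≋0 i → trans (sym (x≋y i)) (x≋0 i)) (λ x≋0 y≋0 i → trans (x≋0 i) (sym (y≋0 i))) 0ᵛ (λ i → refl))
      (#vectors≡[q-1]#points nonzero-Q? (λ x∼y (Qx , x≉0) → Q-resp x∼y Qx , ≉0-resp x∼y x≉0) proj₂) ⟩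
    suc (q-1 ℕ.* ℙ.# (λ P → nonzero-Q? (homogeneous P)))
      ≡⟨ ≡.cong (λ k → suc (q-1 ℕ.* k)) (ℙ.∑-cong (λ P → []-cong (nonzero-Q? (homogeneous P)) (Q? (homogeneous P))
           proj₁ (_, homogeneous-nonzero P))) ⟩
    suc (q-1 ℕ.* ℙ.# (λ P → Q? (homogeneous P)))          ∎
    where
    open ≡.≡-Reasoning
    nonzero-Q? : ∀ x → Dec (Q x × ¬ (x ≋ 0ᵛ))
    nonzero-Q? x = Q? x ×-dec ¬? (x ≋? 0ᵛ)
    split : ∀ x → [ Q? x ] ≡ [ x ≋? 0ᵛ ] ℕ.+ [ nonzero-Q? x ]
    split x = by-cases (x ≋? 0ᵛ)
      where
      by-cases : (x≋0? : Dec (x ≋ 0ᵛ)) → [ Q? x ] ≡ [ x≋0? ] ℕ.+ [ Q? x ×-dec ¬? x≋0? ]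
      by-cases (yes x≋0) = ≡.trans ([]-yes (Q? x) (Q-resp (∼-sym (≋⇒∼ x≋0)) Q0))
        (≡.cong suc (≡.sym ([]-no (Q? x ×-dec ¬? (yes x≋0)) (λ (_ , x≉0) → x≉0 x≋0))))
      by-cases (no x≉0) = []-cong (Q? x) (Q? x ×-dec ¬? (no x≉0)) (_, x≉0) proj₁

  -- The point count (q^n - 1) / (q - 1) without division; the extra 1 is the zero vector, which is
  -- in the kernel but is no point.
  #on : ∀ H → suc (q-1 ℕ.* ℙ.# (λ P → incident? P H)) ≡ q ℕ.^ n
  #on H = ≡.trans
    (≡.sym (#vectors≡1+[q-1]#points (λ x → equation H · x ≟ 0#) (kernel-resp (equation H)) (·-0 (equation H))))
    (#kernel (equation H) (homogeneous-nonzero H))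

  module _ {H₁ H₂ : Hyperplane} (H₁≢H₂ : H₁ ≢ H₂) where

    both? : ∀ x → Dec _
    both? x = (equation H₁ · x ≟ 0#) ×-dec (equation H₂ · x ≟ 0#)

    #both-vectors : 𝕍.# both? ≡ q ℕ.^ suc k
    #both-vectors = ℕ.*-cancelˡ-≡ _ _ q (#kernel₂ (equation H₁) (equation H₂)
      (homogeneous-nonzero H₁) (homogeneous-nonzero H₂)
      (λ H₂∼H₁ → H₁≢H₂ (≡.sym (homogeneous-injective H₂∼H₁))))

    #on-both : suc (q-1 ℕ.* ℙ.# (λ P → incident? P H₁ ×-dec incident? P H₂)) ≡ q ℕ.^ suc k
    #on-both = ≡.trans
      (≡.sym (#vectors≡1+[q-1]#points both?
        (λ x∼y (h₁x≈0 , h₂x≈0) → kernel-resp (equation H₁) x∼y h₁x≈0 , kernel-resp (equation H₂) x∼y h₂x≈0)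
        (·-0 (equation H₁) , ·-0 (equation H₂))))
      #both-vectors

    -- The kernel of the first form has q^n vectors, of which q^(n - 1) are also in the second; the
    -- remaining (q - 1) q^(n - 1) are nonzero and come q - 1 to a point.
    #on-first-only : ℙ.# (λ P → incident? P H₁ ×-dec ¬? (incident? P H₂)) ≡ q ℕ.^ suc k
    #on-first-only = ℕ.*-cancelˡ-≡ _ _ q-1 (ℕ.+-cancelˡ-≡ (q ℕ.^ suc k) _ _ (begin
      r ℕ.+ q-1 ℕ.* ℙ.# (λ P → incident? P H₁ ×-dec ¬? (incident? P H₂))
        ≡⟨ ≡.cong₂ ℕ._+_ (≡.sym #both-vectors)
             (≡.sym (#vectors≡[q-1]#points first? first-resp (λ (_ , h₂x≉0) x≋0 → h₂x≉0 (trans (·-congˡ (equation H₂) x≋0) (·-0 (equation H₂)))))) ⟩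
      𝕍.# both? ℕ.+ 𝕍.# first?                           ≡⟨ 𝕍.∑-+ (λ x → [ both? x ]) (λ x → [ first? x ]) ⟨
      𝕍.∑ (λ x → [ both? x ] ℕ.+ [ first? x ])           ≡⟨ 𝕍.∑-cong (λ x → by-cases (equation H₁ · x ≟ 0#) (equation H₂ · x ≟ 0#)) ⟩
      𝕍.# (λ x → equation H₁ · x ≟ 0#)                   ≡⟨ #kernel (equation H₁) (homogeneous-nonzero H₁) ⟩
      q ℕ.* r                                            ≡⟨ ≡.cong (ℕ._* r) 1+#nonzero ⟨
      r ℕ.+ q-1 ℕ.* r                                    ∎))
      where
      open ≡.≡-Reasoning
      r = q ℕ.^ suc k
      First : Coordinates → Set _
      First x = equation H₁ · x ≈ 0# × ¬ (equation H₂ · x ≈ 0#)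
      first? : ∀ x → Dec (First x)
      first? x = (equation H₁ · x ≟ 0#) ×-dec ¬? (equation H₂ · x ≟ 0#)
      first-resp : First Respects _∼_
      first-resp x∼y (h₁x≈0 , h₂x≉0) = kernel-resp (equation H₁) x∼y h₁x≈0 , λ h₂y≈0 → h₂x≉0 (kernel-resp (equation H₂) (∼-sym x∼y) h₂y≈0)
      by-cases : ∀ {a b} {A : Set a} {B : Set b} (A? : Dec A) (B? : Dec B) → [ A? ×-dec B? ] ℕ.+ [ A? ×-dec ¬? B? ] ≡ [ A? ]
      by-cases (yes _) (yes _) = ≡.refl
      by-cases (yes _) (no _)  = ≡.refl
      by-cases (no _)  _       = ≡.refl

  distinct-hyperplanes : ∃[ H₁ ] ∃[ H₂ ] (H₁ ≢ H₂)
  distinct-hyperplanes = H₁ , H₂ , λ H₁≡H₂ →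
    let s , _ , u≈sv = ∼-trans (≡.subst (λ H → u ∼ homogeneous H) H₁≡H₂ u∼H₁) (∼-sym v∼H₂)
    in 0≉1 (sym (trans (u≈sv zero) (zeroʳ s)))
    where
    u v : Coordinates
    u = unit zero
    v = unit (suc zero)
    point-u = representative u (λ u≋0 → 0≉1 (sym (u≋0 zero)))
    point-v = representative v (λ v≋0 → 0≉1 (sym (v≋0 (suc zero))))
    H₁ = proj₁ point-u
    H₂ = proj₁ point-v
    u∼H₁ = proj₂ point-u
    v∼H₂ = proj₂ point-v

-- The hull

open import Data.Nat using (_≤_; _*_; _^_)

module RowSpans {c ℓ p} (K : FiniteField c ℓ p) where
  open FiniteField K hiding (zero; _*_)
  private module K = FiniteField K
  open FieldProperties K
  open Vectors K
  open Codes K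

  ·-comm : ∀ {m} (u v : Word m) → u · v ≈ v · u
  ·-comm {m} u v = sum-cong-≋ {m} (λ i → *-comm (u i) (v i))

  ·-∑ : ∀ {m l} (u : Word m) (a : Vector Carrier l) (A : Fin l → Word m) →
        u · (λ j → sum (λ i → a i K.* A i j)) ≈ sum (λ i → a i K.* (u · A i))
  ·-∑ {m} {l} u a A = begin
    sum (λ j → u j K.* sum (λ i → a i K.* A i j))      ≈⟨ sum-cong-≋ {m} (λ j → *-distribˡ-sum {l} (u j) _) ⟩
    sum (λ j → sum (λ i → u j K.* (a i K.* A i j)))    ≈⟨ ∑-comm {m} {l} (λ j i → u j K.* (a i K.* A i j)) ⟩
    sum (λ i → sum (λ j → u j K.* (a i K.* A i j)))    ≈⟨ sum-cong-≋ {l} (λ i → ·-* u (a i) (A i)) ⟩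
    sum (λ i → a i K.* (u · A i))                      ∎
    where open import Relation.Binary.Reasoning.Setoid setoid

  module _ {m l} (A : Fin l → Word m) where

    row∈rowSpan : ∀ i → A i ∈ rowSpan A
    row∈rowSpan i = unit i , λ j → sym (trans (·-comm {l} (unit i) (λ k → A k j)) (·-unit {l} (λ k → A k j) i))

    ⊖-rowSpan : ∀ {u v} → u ∈ rowSpan A → v ∈ rowSpan A → (u ⊖ v) ∈ rowSpan A
    ⊖-rowSpan {u} {v} (a , u≈) (b , v≈) = (a +ᵛ - 1# *ᵛ b) , λ j → begin
      u j - v j                                                              ≈⟨ +-cong (u≈ j) (trans (sym (-1*x≈-x _)) (*-congˡ (v≈ j))) ⟩
      a · column j + - 1# K.* (b · column j)                                   ≈⟨ +-congˡ (*-· (- 1#) b (column j)) ⟨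
      a · column j + (- 1# *ᵛ b) · column j                                  ≈⟨ +-cong (·-comm a _) (·-comm (- 1# *ᵛ b) _) ⟩
      column j · a + column j · (- 1# *ᵛ b)                                  ≈⟨ ·-+ (column j) a (- 1# *ᵛ b) ⟨
      column j · (a +ᵛ - 1# *ᵛ b)                                            ≈⟨ ·-comm (column j) _ ⟩
      (a +ᵛ - 1# *ᵛ b) · column j                                            ∎
      where
      open import Relation.Binary.Reasoning.Setoid setoid
      column : Fin m → Word l
      column j i = A i j

module Hull {c ℓ c′ ℓ′ p q} (k : ℕ) (p-prime : Prime p) {h : ℕ} (q≡p^1+h : q ≡ p ^ suc h)
            (F : FiniteField c ℓ q) (K : FiniteField c′ ℓ′ p) where
  private
    n : ℕ
    n = suc (suc k)
    module F = FiniteField F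
    module FP = FieldProperties F
    module FV = Vectors F
  open FiniteField K hiding (zero; _*_; _≟_)
  private module K = FiniteField K
  open FieldProperties K hiding (_^_)
  open Vectors K
  open RowSpans K
  open Points F n using (module ℙ; #vectors≡[q-1]#points)
  open HyperplaneCounts F k
  open PowerSums F {suc n} using (powerSum; powerSum-cong; powerSum-*; powerSum-0; powerSum-support)
  open PointHyperplaneCode n F K
  open import Relation.Binary.Reasoning.Setoid setoid

  p∣q^ : ∀ m → p ∣ q ^ suc m
  p∣q^ m = ∣.∣-trans (≡.subst (p ∣_) (≡.sym q≡p^1+h) (∣.m∣m*n (p ^ h))) (∣.m∣m*n (q ^ m))

  private
    module KChar = Characteristic p-prime ×1≈0
    module FChar = FP.Characteristic p-prime (FP.prime-characteristic {p} (suc h) q≡p^1+h)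

  -- 1 + (q - 1) N ≡ 1 - N modulo p.
  ×1≈1 : ∀ N m → suc (q-1 * N) ≡ q ^ suc m → N ×′ 1# ≈ 1#
  ×1≈1 N m eq = +-cancelʳ ((q-1 * N) ×′ 1#) _ _ (begin
    N ×′ 1# + (q-1 * N) ×′ 1#     ≈⟨ ×-homo-+ 1# N (q-1 * N) ⟨
    (suc q-1 * N) ×′ 1#           ≡⟨ ≡.cong (λ q → (q * N) ×′ 1#) FP.1+#nonzero ⟩
    (q * N) ×′ 1#                 ≈⟨ KChar.∣⇒×1≈0 (∣.∣-trans (≡.subst (p ∣_) (ℕ.*-identityʳ q) (p∣q^ 0)) (∣.m∣m*n N)) ⟩
    0#                            ≈⟨ KChar.∣⇒×1≈0 (≡.subst (p ∣_) (≡.sym eq) (p∣q^ m)) ⟨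
    1# + (q-1 * N) ×′ 1#          ∎)

  indicator : ∀ {a} {A : Set a} (A? : Dec A) → (if does A? then 1# else 0#) ≈ [ A? ] ×′ 1#
  indicator (yes _) = sym (+-identityʳ 1#)
  indicator (no _)  = refl

  incidence-· : ∀ H₁ H₂ → incidenceVector H₁ · incidenceVector H₂ ≈ ℙ.# (λ P → incident? P H₁ ×-dec incident? P H₂) ×′ 1#
  incidence-· H₁ H₂ = trans
    (sum-cong-≋ {θ} (λ P → trans
      (*-cong (indicator (incident? P H₁)) (indicator (incident? P H₂)))
      (trans (sym (×1-homo-* [ incident? P H₁ ] [ incident? P H₂ ]))
        (reflexive (≡.cong (_×′ 1#) (≡.sym ([]-× (incident? P H₁) (incident? P H₂))))))))
    (sum-×1 (λ P → [ incident? P H₁ ×-dec incident? P H₂ ]))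

  -- The product counts common points. A hyperplane, or the intersection of two, has (q^m - 1) / (q
  -- - 1) points with m positive, which is 1 modulo p.
  incidence-·≈1 : ∀ H₁ H₂ → incidenceVector H₁ · incidenceVector H₂ ≈ 1#
  incidence-·≈1 H₁ H₂ = by-cases (H₁ Fin.≟ H₂)
    where
    by-cases : Dec (H₁ ≡ H₂) → incidenceVector H₁ · incidenceVector H₂ ≈ 1#
    -- Here n ≥ 2 matters: q^(n - 1) must be divisible by p. Two distinct points of a projective
    -- line would have product 0.
    by-cases (no  H₁≢H₂)  = trans (incidence-· H₁ H₂) (×1≈1 _ k (#on-both H₁≢H₂))
    by-cases (yes ≡.refl) = trans (incidence-· H₁ H₁) (×1≈1 _ (suc k) (≡.trans
      (≡.cong (λ N → suc (q-1 * N)) (ℙ.∑-cong (λ P →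
        []-cong (incident? P H₁ ×-dec incident? P H₁) (incident? P H₁) proj₁ (λ on → on , on))))
      (#on H₁)))

  weight≡# : (v : Word θ) → weight v ≡ ℙ.# (λ P → nonzero? (v P))
  weight≡# v = ∣tabulate∣ (λ P → nonzero? (v P))

  module _ {H₁ H₂ : Hyperplane} (H₁≢H₂ : H₁ ≢ H₂) where
    private v = incidenceVector H₁ ⊖ incidenceVector H₂

    difference∈hull : v ∈ hull
    difference∈hull = ⊖-rowSpan incidenceVector (row∈rowSpan incidenceVector H₁) (row∈rowSpan incidenceVector H₂) ,
      λ u (a , u≈) → begin
        v · u                                           ≈⟨ ·-congˡ v u≈ ⟩
        v · (λ P → sum (λ H → a H K.* incidenceVector H P))  ≈⟨ ·-∑ v a incidenceVector ⟩
        sum (λ H → a H K.* (v · incidenceVector H))       ≈⟨ sum-cong-≋ {θ} (λ H → trans (*-congˡ (v·≈0 H)) (zeroʳ (a H))) ⟩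
        sum {θ} (λ H → 0#)                              ≈⟨ sum-replicate-zero θ ⟩
        0#                                              ∎
      where
      v·≈0 : ∀ H → v · incidenceVector H ≈ 0#
      v·≈0 H = begin
        v · χ                                                              ≈⟨ ·-comm v χ ⟩
        χ · v                                                              ≈⟨ ·-congˡ χ (λ P → +-congˡ (sym (-1*x≈-x _))) ⟩
        χ · (incidenceVector H₁ +ᵛ - 1# *ᵛ incidenceVector H₂)             ≈⟨ ·-+ χ _ _ ⟩
        χ · incidenceVector H₁ + χ · (- 1# *ᵛ incidenceVector H₂)          ≈⟨ +-congˡ (·-* χ (- 1#) _) ⟩
        χ · incidenceVector H₁ + - 1# K.* (χ · incidenceVector H₂)           ≈⟨ +-cong (incidence-·≈1 H H₁) (*-congˡ (incidence-·≈1 H H₂)) ⟩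
        1# + - 1# K.* 1#                                                     ≈⟨ +-congˡ (-1*x≈-x 1#) ⟩
        1# - 1#                                                            ≈⟨ -‿inverseʳ 1# ⟩
        0#                                                                 ∎
        where χ = incidenceVector H

    -- Both 1 and -1 are nonzero in `K`, whatever p is, so the support is the symmetric difference
    -- of the two hyperplanes.
    weight-difference : weight v ≡ 2 * q ^ suc k
    weight-difference = ≡-Reasoning.begin
      weight v                                ≡-Reasoning.≡⟨ weight≡# v ⟩
      ℙ.# (λ P → nonzero? (v P))              ≡-Reasoning.≡⟨ ℙ.∑-cong (λ P → by-cases (incident? P H₁) (incident? P H₂)) ⟩
      ℙ.∑ (λ P → [ first? H₁ H₂ P ] ℕ.+ [ first? H₂ H₁ P ])  ≡-Reasoning.≡⟨ ℙ.∑-+ (λ P → [ first? H₁ H₂ P ]) (λ P → [ first? H₂ H₁ P ]) ⟩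
      ℙ.# (first? H₁ H₂) ℕ.+ ℙ.# (first? H₂ H₁)
        ≡-Reasoning.≡⟨ ≡.cong₂ ℕ._+_ (#on-first-only H₁≢H₂) (≡.trans (#on-first-only (H₁≢H₂ ∘ ≡.sym)) (≡.sym (ℕ.+-identityʳ _))) ⟩
      2 * q ^ suc k                           ≡-Reasoning.∎
      where
      module ≡-Reasoning = ≡.≡-Reasoning
      first? : ∀ G H P → Dec (Incident P G × ¬ Incident P H)
      first? G H P = incident? P G ×-dec ¬? (incident? P H)
      by-cases : ∀ {a b} {A : Set a} {B : Set b} (A? : Dec A) (B? : Dec B) →
        [ nonzero? ((if does A? then 1# else 0#) - (if does B? then 1# else 0#)) ] ≡ [ A? ×-dec ¬? B? ] ℕ.+ [ B? ×-dec ¬? A? ]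
      by-cases (yes _) (yes _) = []-no  (nonzero? (1# - 1#)) (λ ≉0 → ≉0 (-‿inverseʳ 1#))
      by-cases (yes _) (no _)  = []-yes (nonzero? (1# - 0#)) (λ ≈0 → 0≉1 (sym (x∙y⁻¹≈ε⇒x≈y 1# 0# ≈0)))
      by-cases (no _)  (yes _) = []-yes (nonzero? (0# - 1#)) (λ ≈0 → 0≉1 (x∙y⁻¹≈ε⇒x≈y 0# 1# ≈0))
      by-cases (no _)  (no _)  = []-no  (nonzero? (0# - 0#)) (λ ≉0 → ≉0 (-‿inverseʳ 0#))

  private
    q≡2+ : q ≡ 2 ℕ.+ ℕ.pred q-1
    q≡2+ = ≡.trans (≡.sym FP.1+#nonzero) (≡.cong suc (≡.sym (ℕ.suc-pred q-1)))

  -- The weight of an arbitrary nonzero hull word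

  module _ {v : Word θ} (v∈hull : v ∈ hull) {P₀ : Point} (v≉0 : ¬ (v P₀ ≈ 0#)) where
    private
      a : Vector Carrier θ
      a = proj₁ (proj₁ v∈hull)

      v≈ : v ≋ (λ P → sum (λ H → a H K.* incidenceVector H P))
      v≈ = proj₂ (proj₁ v∈hull)

      -- All rows have product 1 with a fixed row χ, so χ · v is the sum of the coefficients, and it
      -- is zero as v lies in the dual. Any row would do; `P₀` supplies one because points and
      -- hyperplanes share the index type `Fin θ`.
      sum-a≈0 : sum a ≈ 0#
      sum-a≈0 = begin
        sum a                                               ≈⟨ sum-cong-≋ {θ} (λ H → trans (*-congˡ (incidence-·≈1 P₀ H)) (*-identityʳ (a H))) ⟨
        sum (λ H → a H K.* (χ · incidenceVector H))         ≈⟨ ·-∑ χ a incidenceVector ⟨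
        χ · (λ P → sum (λ H → a H K.* incidenceVector H P)) ≈⟨ ·-congˡ χ v≈ ⟨
        χ · v                                               ≈⟨ ·-comm χ v ⟩
        v · χ                                               ≈⟨ proj₂ v∈hull χ (row∈rowSpan incidenceVector P₀) ⟩
        0#                                                  ∎
        where χ = incidenceVector P₀

      -- Natural numbers representing the coefficients carry them over from K to F.
      κ : Hyperplane → ℕ
      κ H = proj₁ (×1-surjective p-prime (a H))

      a≈κ : ∀ H → a H ≈ κ H ×′ 1#
      a≈κ H = proj₂ (×1-surjective p-prime (a H))

      -- Read in `K`, `on P` is the value of v; read in `F`, `off P` is the value of the power sum
      -- `f`. Together they make up the sum of all `κ H`, which p divides.
      on off : Point → ℕ
      on  P = sumℕ (λ H → κ H * [ incident? P H ])
      off P = sumℕ (λ H → κ H * [ ¬? (incident? P H) ])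

      p∣on+off : ∀ P → p ∣ on P ℕ.+ off P
      p∣on+off P = ≡.subst (p ∣_)
        (≡.trans (ΣN.sum-cong-≗ {θ} split) (ΣN.∑-distrib-+ {θ} _ _))
        (KChar.×1≈0⇒∣ (sumℕ κ) (trans (sym (sum-×1 κ)) (trans (sum-cong-≋ {θ} (λ H → sym (a≈κ H))) sum-a≈0)))
        where
        split : ∀ H → κ H ≡ κ H * [ incident? P H ] ℕ.+ κ H * [ ¬? (incident? P H) ]
        split H = ≡.trans (≡.sym (ℕ.*-identityʳ (κ H)))
          (≡.trans (≡.cong (κ H *_) (≡.sym ([]-¬ (incident? P H)))) (ℕ.*-distribˡ-+ (κ H) _ _))

      v≈on : ∀ P → v P ≈ on P ×′ 1#
      v≈on P = begin
        v P                                                 ≈⟨ v≈ P ⟩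
        sum (λ H → a H K.* incidenceVector H P)             ≈⟨ sum-cong-≋ {θ} (λ H → trans (*-cong (a≈κ H) (indicator (incident? P H)))
                                                                 (sym (×1-homo-* (κ H) [ incident? P H ]))) ⟩
        sum (λ H → (κ H * [ incident? P H ]) ×′ 1#)         ≈⟨ sum-×1 {θ} _ ⟩
        on P ×′ 1#                                          ∎

      f : Coordinates → F.Carrier
      f = powerSum (λ H → κ H FP.×′ F.1#) equation

      f≈off : ∀ P → f (homogeneous P) F.≈ off P FP.×′ F.1#
      f≈off P = F.trans
        (FP.sum-cong-≋ {θ} (λ H → F.trans (F.*-congˡ (FP.fermat-indicator (equation H F.· homogeneous P)))
          (F.sym (FP.×1-homo-* (κ H) [ ¬? (incident? P H) ]))))
        (FP.sum-×1 {θ} _)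

      -- This and its converse take the place of the equation v = -f, whose sides lie in different
      -- fields: p divides `on P` exactly when it divides `off P`.
      v≈0⇒f≈0 : ∀ P → v P ≈ 0# → f (homogeneous P) F.≈ F.0#
      v≈0⇒f≈0 P vP≈0 = F.trans (f≈off P) (FChar.∣⇒×1≈0
        (∣.∣m+n∣m⇒∣n (p∣on+off P) (KChar.×1≈0⇒∣ (on P) (trans (sym (v≈on P)) vP≈0))))

      f≈0⇒v≈0 : ∀ P → f (homogeneous P) F.≈ F.0# → v P ≈ 0#
      f≈0⇒v≈0 P fP≈0 = trans (v≈on P) (KChar.∣⇒×1≈0
        (∣.∣m+n∣m⇒∣n (≡.subst (p ∣_) (ℕ.+-comm (on P) (off P)) (p∣on+off P))
          (FChar.×1≈0⇒∣ (off P) (F.trans (F.sym (f≈off P)) fP≈0))))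

      support≡ : FV.𝕍.# (λ x → FP.nonzero? (f x)) ≡ q-1 * weight v
      support≡ = ≡.trans
        (#vectors≡[q-1]#points (λ x → FP.nonzero? (f x)) f≉0-resp
          (λ fx≉0 x≋0 → fx≉0 (F.trans (powerSum-cong _ equation x≋0) (powerSum-0 _ equation))))
        (≡.cong (q-1 *_) (≡.trans
          (ℙ.∑-cong (λ P → []-cong (FP.nonzero? (f (homogeneous P))) (nonzero? (v P))
            (λ f≉0 vP≈0 → f≉0 (v≈0⇒f≈0 P vP≈0)) (λ vP≉0 f≈0 → vP≉0 (f≈0⇒v≈0 P f≈0))))
          (≡.sym (weight≡# v))))
        where
        f≉0-resp : ∀ {x y} → x ∼ y → ¬ f x F.≈ F.0# → ¬ f y F.≈ F.0#
        f≉0-resp {x} {y} (s , s≉0 , x≈sy) fx≉0 fy≈0 = fx≉0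
          (F.trans (powerSum-cong _ equation x≈sy) (F.trans (powerSum-* _ equation s≉0 y) fy≈0))

    hull-weight≥ : 2 * q ^ suc k ≤ weight v
    -- The claim is multiplied by q - 1, increased by 2r on both sides and multiplied by q^2. As
    -- q^(n + 1) = q^2 r and 1 + (q - 1) = q, it becomes `powerSum-support` in n + 1 coordinates.
    hull-weight≥ = ℕ.*-cancelˡ-≤ q-1 (ℕ.+-cancelʳ-≤ (2 * r) _ _ (ℕ.*-cancelˡ-≤ (q * q) {{ℕ.m*n≢0 q q}} (ℕ-Reasoning.begin
      q * q * (q-1 * (2 * r) ℕ.+ 2 * r)                ℕ-Reasoning.≡⟨ ℕSolver.solve 3 (λ q d r → q :* q :* (d :* (con 2 :* r) :+ con 2 :* r) :=
                                                              con 2 :* ((con 1 :+ d) :* (q :* (q :* r)))) ≡.refl q q-1 r ⟩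
      2 * (suc q-1 * (q * (q * r)))                    ℕ-Reasoning.≡⟨ ≡.cong (λ s → 2 * (s * (q * (q * r)))) FP.1+#nonzero ⟩
      2 * (q * q ^ suc n)                              ℕ-Reasoning.≤⟨ powerSum-support _ equation q≡2+ (homogeneous P₀) (λ f≈0 → v≉0 (f≈0⇒v≈0 P₀ f≈0)) ⟩
      q * (q * FV.𝕍.# (λ x → FP.nonzero? (f x))) ℕ.+ 2 * q ^ suc n
                                                       ℕ-Reasoning.≡⟨ ≡.cong (λ N → q * (q * N) ℕ.+ 2 * q ^ suc n) support≡ ⟩
      q * (q * (q-1 * weight v)) ℕ.+ 2 * (q * (q * r)) ℕ-Reasoning.≡⟨ ℕSolver.solve 3 (λ q s r → q :* (q :* s) :+ con 2 :* (q :* (q :* r)) :=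
                                                              q :* q :* (s :+ con 2 :* r)) ≡.refl q (q-1 * weight v) r ⟩
      q * q * (q-1 * weight v ℕ.+ 2 * r)               ℕ-Reasoning.∎)))
      where
      r = q ^ suc k
      module ℕ-Reasoning = ℕ.≤-Reasoning
      module ℕSolver = Data.Nat.Solver.+-*-Solver
      open ℕSolver using (_:=_; _:+_; _:*_; con)

  weight>0⇒nonzero : ∀ {v} → 0 ℕ.< weight v → ¬ (v ≋ 0ᵛ)
  weight>0⇒nonzero {v} 0<weight v≋0 = ℕ.<⇒≢ 0<weight
    (≡.sym (≡.trans (weight≡# v) (ℙ.#≡0 (λ P → nonzero? (v P)) (λ P vP≉0 → vP≉0 (v≋0 P)))))

  hull-minimum-weight : IsMinimumWeight hull (2 * q ^ suc k)
  hull-minimum-weight = attained distinct-hyperplanes , λ v v∈hull v≉0 →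
    let P , vP≉0 = Fin.¬∀⟶∃¬ θ _ (λ P → v P K.≟ 0#) v≉0 in hull-weight≥ v∈hull vP≉0
    where
    attained : ∃[ H₁ ] ∃[ H₂ ] H₁ ≢ H₂ → ∃[ v ] v ∈ hull × ¬ (v ≋ 0ᵛ) × weight v ≡ 2 * q ^ suc k
    attained (H₁ , H₂ , H₁≢H₂) =
      incidenceVector H₁ ⊖ incidenceVector H₂ , difference∈hull H₁≢H₂ ,
      weight>0⇒nonzero (≡.subst (0 ℕ.<_) (≡.sym (weight-difference H₁≢H₂))
        (ℕ.*-mono-≤ (s≤s {n = 1} z≤n) (ℕ.m^n>0 q (suc k)))) ,
      weight-difference H₁≢H₂

mainTheorem1 : ∀ {c ℓ c′ ℓ′} (n p h : ℕ) → 2 ≤ n → Prime p → 1 ≤ h →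
    (F : FiniteField c ℓ (p ^ h)) (K : FiniteField c′ ℓ′ p) →
    let open PointHyperplaneCode n F K in
    IsMinimumWeight hull (2 * (p ^ h) ^ (n ∸ 1)) ×
    (∀ (H₁ H₂ : Hyperplane) → H₁ ≢ H₂ →
    let v = incidenceVector H₁ ⊖ incidenceVector H₂ in
    v ∈ hull × weight v ≡ 2 * (p ^ h) ^ (n ∸ 1))
mainTheorem1 (suc (suc k)) p (suc h) (s≤s (s≤s z≤n)) p-prime (s≤s z≤n) F K =
  hull-minimum-weight , λ H₁ H₂ H₁≢H₂ → difference∈hull H₁≢H₂ , weight-difference H₁≢H₂
  where open Hull k p-prime {h} ≡.refl F K
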